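{- The class $\mathcal S^*$ has the Ramsey property.
   Context: In a directed graph write $x\perp y$ iff neither $(x,y)$ nor $(y,x)$ is an edge. Let $\mathcal S$ be the class of finite directed graphs in which $\perp$ is an equivalence relation (classes called parts; $k$-partite means exactly $k$ parts) and which satisfy the parity constraint: for any two distinct parts $P,P'$, distinct $u,v\in P$ and distinct $x,y\in P'$, the number of edges directed from $\{u,v\}$ to $\{x,y\}$ is even (its Fraïssé limit is the semigeneric directed graph). The class $\mathcal S^*$ consists of the structures $(A,E,R,<)$ obtained as follows from a $k$-partite $\mathbf A=(A,E)\in\mathcal S$ ($k$ arbitrary): take a $k$-partite $\bar{\mathbf A}\in\mathcal S$ with universe $A\sqcup\{t_0,\dots,t_{k-1}\}$ in which $\mathbf A$ is an induced subgraph, each part contains exactly one $t_i$, and $(t_i,t_j)$ is an edge whenever $i<j$; for $x,u\in A$ in different parts set $R(x,u)$ iff $(t_i,u)$ is an edge of $\bar{\mathbf A}$, where $t_i$ lies in the part of $x$; and let $<$ be the restriction to $A$ of a linear order on $\bar A$ extending $t_0<\dots<t_{k-1}$ and convex with respect to the parts. A class $\mathcal K$ of finite structures has the Ramsey property if for all $r\in\mathbb N$ and $\mathbf A,\mathbf B\in\mathcal K$ there is $\mathbf C\in\mathcal K$ such that for every colouring of the substructures of $\mathbf C$ isomorphic to $\mathbf A$ with $r$ colours there is a substructure $\mathbf B'\cong\mathbf B$ of $\mathbf C$ on whose substructures isomorphic to $\mathbf A$ the colouring is constant. -}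

module Defs where

open import Data.Nat using (ℕ; zero; suc; _+_)
open import Data.Nat.Divisibility using (_∣_)
open import Data.Bool using (Bool; true; false; if_then_else_)
open import Data.Fin using (Fin; _↑ˡ_; _↑ʳ_) renaming (_<_ to _<ᶠ_)
open import Data.Fin.Subset using (Subset; _∈_)
open import Data.Product using (Σ; _×_; ∃; ∃-syntax)
open import Relation.Nullary using (¬_)
open import Relation.Binary.PropositionalEquality using (_≡_; _≢_)
open import Relation.Binary.Structures using (IsEquivalence)
open import Function.Definitions using (Injective; Surjective)
open import Data.Sum using (_⊎_)

_⟺_ : Set → Set → Set
P ⟺ Q = (P → Q) × (Q → P)

-- Finite directed graphs on the vertex set Fin n, given by an edge
-- relation E (E x y ≡ true means (x,y) is an edge).

Rel₂ : ℕ → Set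
Rel₂ n = Fin n → Fin n → Bool

Perp : ∀ {n} → Rel₂ n → Fin n → Fin n → Set
Perp E x y = (E x y ≡ false) × (E y x ≡ false)

IsDigraph : ∀ {n} → Rel₂ n → Set
IsDigraph {n} E = (∀ (x : Fin n) → E x x ≡ false)
                × (∀ (x y : Fin n) → E x y ≡ true → E y x ≡ false)

b2n : Bool → ℕ
b2n true  = 1
b2n false = 0

edgesFromTo : ∀ {n} → Rel₂ n → (u v x y : Fin n) → ℕ
edgesFromTo E u v x y = b2n (E u x) + b2n (E u y) + b2n (E v x) + b2n (E v y)

InS : ∀ {n} → Rel₂ n → Set
InS {n} E =
    IsDigraph E
  × IsEquivalence (Perp E)
  × (∀ (u v x y : Fin n) → Perp E u v → Perp E x y → ¬ Perp E u x →
       u ≢ v → x ≢ y → 2 ∣ edgesFromTo E u v x y)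

KPartite : ∀ {n} → Rel₂ n → ℕ → Set
KPartite {n} E k =
  Σ (Fin n → Fin k) λ p →
    Surjective _≡_ _≡_ p × (∀ (x y : Fin n) → Perp E x y ⟺ (p x ≡ p y))

-- Structures (A, E, R, <) on the universe Fin n.  The relation L is the
-- strict linear order <.

record Str : Set where
  field
    size : ℕ
    E    : Rel₂ size
    R    : Rel₂ size
    L    : Rel₂ size
open Str public

IsStrictLinear : ∀ {n} → Rel₂ n → Set
IsStrictLinear {n} lt =
    (∀ (x : Fin n) → lt x x ≡ false)
  × (∀ (x y z : Fin n) → lt x y ≡ true → lt y z ≡ true → lt x z ≡ true)
  × (∀ (x y : Fin n) → x ≢ y → (lt x y ≡ true) ⊎ (lt y x ≡ true))

-- The class 𝒮*.  A vertex a of A is a ↑ˡ k in Ā (universe Fin (n + k)),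
-- the vertex t_i of Ā is n ↑ʳ i.
InSStar : Str → Set
InSStar M =
  let n = size M in
  Σ ℕ λ k →
    InS (E M) × KPartite (E M) k ×
    Σ (Rel₂ (n + k)) λ Ē →
      let t : Fin k → Fin (n + k)
          t i = n ↑ʳ i
          a : Fin n → Fin (n + k)
          a x = x ↑ˡ k
      in
        InS Ē × KPartite Ē k
      × (∀ (x y : Fin n) → Ē (a x) (a y) ≡ E M x y)
      × (∀ (w : Fin (n + k)) → ∃[ i ] Perp Ē w (t i))
      × (∀ (i j : Fin k) → Perp Ē (t i) (t j) → i ≡ j)
      × (∀ (i j : Fin k) → i <ᶠ j → Ē (t i) (t j) ≡ true)
      × (∀ (x u : Fin n) →
           (R M x u ≡ true) ⟺
           (¬ Perp (E M) x u × ∃[ i ] (Perp Ē (a x) (t i) × Ē (t i) (a u) ≡ true)))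
      × Σ (Rel₂ (n + k)) λ lt →
            IsStrictLinear lt
          × (∀ (i j : Fin k) → i <ᶠ j → lt (t i) (t j) ≡ true)
          × (∀ (w₁ w₂ w₃ : Fin (n + k)) → lt w₁ w₂ ≡ true → lt w₂ w₃ ≡ true →
               Perp Ē w₁ w₃ → Perp Ē w₁ w₂)
          × (∀ (x y : Fin n) → L M x y ≡ lt (a x) (a y))

record Emb (A C : Str) : Set where
  field
    fun  : Fin (size A) → Fin (size C)
    inj  : Injective _≡_ _≡_ fun
    presE : ∀ x y → E A x y ≡ E C (fun x) (fun y)
    presR : ∀ x y → R A x y ≡ R C (fun x) (fun y)
    presL : ∀ x y → L A x y ≡ L C (fun x) (fun y)
open Emb public

IsCopy : (A C : Str) → Subset (size C) → Set
IsCopy A C S = Σ (Emb A C) λ e → ∀ x → (x ∈ S) ⟺ (∃[ y ] fun e y ≡ x)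

InImage : ∀ {B C : Str} → Subset (size C) → Emb B C → Set
InImage {B} {C} S g = ∀ x → x ∈ S → ∃[ y ] fun g y ≡ x

-- The Ramsey property for a class 𝒦 of finite structures.
-- Colourings of the copies of A in C are given as functions on all
-- subsets of the universe of C (only their values on copies matter).
RamseyProperty : (Str → Set) → Set
RamseyProperty K =
  ∀ (r : ℕ) (A B : Str) → K A → K B →
    Σ Str λ C → K C ×
      ∀ (χ : Subset (size C) → Fin r) →
        Σ (Emb B C) λ g → Σ (Fin r) λ c →
          ∀ (S : Subset (size C)) → IsCopy A C S → InImage {B} {C} S g → χ S ≡ c

{-# OPTIONS --safe #-}

-- By the parity constraint a structure of 𝒮* is determined by its linear order, the part of each vertex
-- and the relation "(t_i, u) is an edge" between parts and vertices of other parts, which is arbitrary.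
-- Let C_n have the subsets T of [n] as parts and the pairs (T, U) of subsets as vertices of the part T,
-- both in lexicographic order, with (t_T, (T′, U)) an edge iff T meets U.  Give B one parameter for each
-- part, each vertex and each pair of a part and a vertex.  A word W of length n in these parameters turns
-- sets of parameters into subsets of [n] and so places a copy of B in C_n.  An embedding of A into B
-- corresponds to a word v merging the parameters of B into those of A, and the copy of A that it cuts out
-- of the copy of B at W is the one at W ⊙ v.  So the theorem follows from the Graham–Rothschild theorem
-- on parameter words, which in turn follows from the Hales–Jewett theorem.
module Submission where

open import Defs

open import Data.Bool using (Bool; true; false; _∧_; _∨_; not; _xor_; if_then_else_)
open import Data.Bool.Properties using (xor-comm)
open import Data.Fin using (Fin; zero; suc; toℕ; combine; funToFin; finToFun; _↑ˡ_; _↑ʳ_; splitAt; fromℕ<; punchOut; remQuot; quotient; remainder)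
open import Data.Fin.Properties using (any?; _≟_; finToFun-funToFin; injective⇒≤; toℕ-injective; splitAt-↑ˡ; splitAt-↑ʳ; combine-monoˡ-<; combine-injectiveʳ; toℕ-combine; toℕ-fromℕ<; punchOut-injective; toℕ-↑ˡ; <⇒≢; ↑ˡ-injective; remQuot-combine; combine-remQuot)
open import Data.Fin.Subset using (Subset; _∈_; ∣_∣; ⊥)
open import Data.Fin.Subset.Properties using (p⊂q⇒∣p∣<∣q∣; ⊆-antisym; ∈⊤; ∣⊤∣≡n; ⊆⊤)
open import Data.List using (List; length) renaming ([] to []ˡ; _∷_ to _∷ˡ_)
open import Data.Maybe using (Maybe; just; nothing; fromMaybe) renaming (map to mapᴹ)
open import Data.Nat using (ℕ; zero; suc; _+_; _*_; _^_; _≤_; _<_; z≤n; s≤s; _≤?_; s≤s⁻¹; _<?_; _<ᵇ_)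
open import Algebra.Definitions.RawMonoid Data.Nat.+-0-rawMonoid using (sum)
open import Data.Nat.Divisibility using (_∣_; divides; _∣?_)
open import Data.Nat.Properties using (≤-refl; ≤-trans; ≤-reflexive; n≮n; m≤n+m; m≤m+n; +-suc; <⇒≱; ≤∧≢⇒<; ≤-antisym; ≰⇒>; n≤0⇒n≡0; ≮⇒≥; <⇒≤; <-cmp; +-monoʳ-<; <-trans; +-mono-≤; *-monoʳ-≤)
open import Data.Product using (Σ; ∃; _×_; _,_; proj₁; proj₂; ∃-syntax; uncurry)
open import Data.Sum using (_⊎_; inj₁; inj₂; [_,_]′)
open import Data.Vec using (Vec; []; _∷_; _++_; map; lookup; tabulate; replicate; toList)
open import Data.Vec.Functional using (updateAt)
open import Data.Vec.Functional.Properties using (updateAt-updates; updateAt-minimal)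
open import Data.Vec.Properties using (lookup∘tabulate; tabulate-cong; []=⇒lookup; lookup⇒[]=)
open import Function using (_∘_; id; case_of_)
open import Function.Definitions using (Injective)
open import Relation.Binary.Definitions using (tri<; tri≈; tri>)
open import Relation.Binary.PropositionalEquality using (_≡_; _≢_; _≗_; refl; sym; trans; cong; cong₂; subst; module ≡-Reasoning; subst₂)
open import Relation.Binary.Structures using (IsEquivalence)
open import Relation.Nullary using (¬_; Dec; yes; no; contradiction; does)
open import Relation.Nullary.Decidable using (dec-true; dec-false; from-no)
import Data.Sum as Sum

-- Substitution into a word respects both ingredients of the target structure. Parameters first
-- occur in order, so two substitutions differ for the first time where the first parameter on which
-- they disagree opens, and the lexicographic order survives. Every parameter occurs and the letter
-- lies in no set, so meeting and being disjoint survive as well. The parameters of single parts and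
-- single vertices have two duties that the pairs cannot fulfil. They are the first elements of
-- their sets, which fixes the order whatever the relation is; and, together with one parameter for
-- "neither", they absorb the pairs that lose their part or their vertex on restriction from B to A,
-- without disturbing the order of first occurrences. The induction for Graham-Rothschild is on the
-- number of parameters of the coloured words. It works because a parameter, once opened, is just
-- one more letter: the induction hypothesis over the larger alphabet confines the colour to what
-- precedes the first parameter, and Hales-Jewett with a pigeonhole argument removes that
-- dependence.

private variable
  a b k m n r : ℕ
  X Y : Set

infixr 5 _▸_
_▸_ : X → (Fin n → X) → Fin (suc n) → X
(x ▸ f) zero    = x
(x ▸ f) (suc i) = f i

▸-cong : ∀ (x : X) {f g : Fin n → X} → f ≗ g → x ▸ f ≗ x ▸ g
▸-cong x f≗g zero    = refl
▸-cong x f≗g (suc i) = f≗g i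

∘-▸ : ∀ (h : X → Y) x (f : Fin n → X) → h ∘ (x ▸ f) ≗ h x ▸ (h ∘ f)
∘-▸ h x f zero    = refl
∘-▸ h x f (suc i) = refl

-- The Hales–Jewett theorem

-- The value is r^(b^n), the number of colourings of the words of length `n`. In the product
-- arguments below, a whole colouring of the tail is the colour of a head.
CodeSize : ℕ → ℕ → ℕ → ℕ
CodeSize b r zero    = r
CodeSize b r (suc n) = CodeSize b r n ^ b

encode : (Vec (Fin b) n → Fin r) → Fin (CodeSize b r n)
encode {n = zero}  g = g []
encode {n = suc n} g = funToFin λ x → encode λ w → g (x ∷ w)

funToFin-injective : (f g : Fin m → Fin n) → funToFin f ≡ funToFin g → f ≗ g
funToFin-injective f g eq i =
  trans (sym (finToFun-funToFin f i)) (trans (cong (λ c → finToFun c i) eq) (finToFun-funToFin g i))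

encode-injective : (f g : Vec (Fin b) n → Fin r) → encode f ≡ encode g → f ≗ g
encode-injective f g eq []      = eq
encode-injective f g eq (x ∷ w) =
  encode-injective (f ∘ (x ∷_)) (g ∘ (x ∷_)) (funToFin-injective _ _ eq x) w

Template : Set → ℕ → Set
Template X n = Vec (Maybe X) n

data Active {X : Set} : Template X n → Set where
  here  : ∀ {L : Template X n} → Active (nothing ∷ L)
  there : ∀ {x} {L : Template X n} → Active L → Active (x ∷ L)

fill : Template X n → X → Vec X n
fill L x = map (fromMaybe x) L

active-++ : ∀ {L : Template X m} (L′ : Template X n) → Active L → Active (L ++ L′)
active-++ L′ here      = here
active-++ L′ (there v) = there (active-++ L′ v)

active-map : ∀ (f : X → Y) {L : Template X n} → Active L → Active (map (mapᴹ f) L)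
active-map f here      = here
active-map f (there v) = there (active-map f v)

active-++ʳ : ∀ (L : Template X m) {L′ : Template X n} → Active L′ → Active (L ++ L′)
active-++ʳ []      v = v
active-++ʳ (x ∷ L) v = there (active-++ʳ L v)

fill-++ : ∀ (L : Template X m) (L′ : Template X n) x → fill (L ++ L′) x ≡ fill L x ++ fill L′ x
fill-++ []      L′ x = refl
fill-++ (y ∷ L) L′ x = cong (_ ∷_) (fill-++ L L′ x)

fill-just : ∀ (w : Vec X n) x → fill (map just w) x ≡ w
fill-just []      x = refl
fill-just (y ∷ w) x = cong (y ∷_) (fill-just w x)

fill-map : ∀ (f : X → Y) (L : Template X n) x → fill (map (mapᴹ f) L) (f x) ≡ map f (fill L x)
fill-map f []            x = refl
fill-map f (just y ∷ L)  x = cong (f y ∷_) (fill-map f L x)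
fill-map f (nothing ∷ L) x = cong (f x ∷_) (fill-map f L x)

MonoLine : (Vec X n → Y) → Set
MonoLine {X} {n} χ = Σ (Template X n) λ L → Active L × ∀ x y → χ (fill L x) ≡ χ (fill L y)

HJ : ℕ → Set
HJ a = ∀ r → ∃ λ n → ∀ (χ : Vec (Fin a) n → Fin r) → MonoLine χ

-- Colour focusing: `zero` is the new letter. Each of the `s` lines is monochromatic on the old
-- letters, the colours are distinct, and all lines meet in one point at the new letter.
record Focused (a s : ℕ) (χ : Vec (Fin (suc a)) n → Fin r) : Set where
  field
    focus         : Vec (Fin (suc a)) n
    colour        : Fin s → Fin r
    colour-inj    : Injective _≡_ _≡_ colour
    line          : Fin s → Template (Fin (suc a)) n
    line-active   : ∀ i → Active (line i)
    line-focus    : ∀ i → fill (line i) zero ≡ focus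
    line-colour   : ∀ i x → χ (fill (line i) (suc x)) ≡ colour i
    focus-colour  : ∀ i → χ focus ≢ colour i

focused-full : ∀ {χ : Vec (Fin (suc a)) n → Fin r} → ¬ Focused a (suc r) χ
focused-full F = n≮n _ (injective⇒≤ (Focused.colour-inj F))

module _ {a : ℕ} where

  -- The points of `L` at old letters all induce the same colouring of the tail. Hence every focused
  -- line of the tail keeps its colour when the variable moves both blocks at once, and `L` followed
  -- by the constant tail `focus` is one more line. Its colour is that of the old focus, which
  -- `focus-colour` makes new.
  focus-step : ∀ (χ : Vec (Fin (suc (suc a))) (m + n) → Fin r) {s}
    (L : Template (Fin (suc a)) m) → Active L →
    (∀ x y w → χ (map suc (fill L x) ++ w) ≡ χ (map suc (fill L y) ++ w)) →
    MonoLine (λ w → χ (map suc (fill L zero) ++ w))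
      ⊎ Focused (suc a) s (λ w → χ (map suc (fill L zero) ++ w)) →
    MonoLine χ ⊎ Focused (suc a) (suc s) χ
  focus-step χ L act const (inj₁ (L′ , act′ , mono)) =
    inj₁ (map just u ++ L′ , active-++ʳ (map just u) act′ , λ x y →
      trans (cong χ (eq x)) (trans (mono x y) (sym (cong χ (eq y)))))
    where
    u = map suc (fill L zero)
    eq : ∀ x → fill (map just u ++ L′) x ≡ u ++ fill L′ x
    eq x = trans (fill-++ (map just u) L′ x) (cong (_++ fill L′ x) (fill-just u x))
  focus-step {m} {n} {r} χ {s} L act const (inj₂ F) = result
    where
    open Focused F
    L⁺ = map (mapᴹ suc) L

    focus′ : Vec (Fin (suc (suc a))) (m + n)
    focus′ = fill L⁺ zero ++ focus

    colour′ : Fin (suc s) → Fin r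
    colour′ = χ (map suc (fill L zero) ++ focus) ▸ colour

    colour′-inj : Injective _≡_ _≡_ colour′
    colour′-inj {zero}  {zero}  eq = refl
    colour′-inj {zero}  {suc j} eq = contradiction eq (focus-colour j)
    colour′-inj {suc i} {zero}  eq = contradiction (sym eq) (focus-colour i)
    colour′-inj {suc i} {suc j} eq = cong suc (colour-inj eq)

    tail′ : Fin (suc s) → Template (Fin (suc (suc a))) n
    tail′ = map just focus ▸ line

    line′ : Fin (suc s) → Template (Fin (suc (suc a))) (m + n)
    line′ i = L⁺ ++ tail′ i

    active′ : ∀ i → Active (line′ i)
    active′ i = active-++ (tail′ i) (active-map suc act)

    line′-focus : ∀ i → fill (line′ i) zero ≡ focus′
    line′-focus i = trans (fill-++ L⁺ (tail′ i) zero) (cong (fill L⁺ zero ++_) (tail-focus i))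
      where
      tail-focus : ∀ i → fill (tail′ i) zero ≡ focus
      tail-focus zero    = fill-just focus zero
      tail-focus (suc i) = line-focus i

    line′-colour : ∀ i x → χ (fill (line′ i) (suc x)) ≡ colour′ i
    line′-colour i x = trans (cong χ (trans (fill-++ L⁺ (tail′ i) (suc x))
                          (cong (_++ fill (tail′ i) (suc x)) (fill-map suc L x))))
                        (trans (const x zero _) (tail-colour i))
      where
      tail-colour : ∀ i → χ (map suc (fill L zero) ++ fill (tail′ i) (suc x)) ≡ colour′ i
      tail-colour zero    = cong (λ w → χ (map suc (fill L zero) ++ w)) (fill-just focus (suc x))
      tail-colour (suc i) = line-colour i x

    result : MonoLine χ ⊎ Focused (suc a) (suc s) χ
    -- A line that shares its colour with the new focus is monochromatic on all letters, the new one
    -- included.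
    result with any? (λ i → χ focus′ ≟ colour′ i)
    ... | no  ≢c = inj₂ record
      { focus = focus′ ; colour = colour′ ; colour-inj = colour′-inj ; line = line′
      ; line-active = active′ ; line-focus = line′-focus ; line-colour = line′-colour
      ; focus-colour = λ i eq → ≢c (i , eq) }
    ... | yes (i , eq) = inj₁ (line′ i , active′ i , λ x y → trans (all x) (sym (all y)))
      where
      all : ∀ x → χ (fill (line′ i) x) ≡ colour′ i
      all zero    = trans (cong χ (line′-focus i)) eq
      all (suc x) = line′-colour i x

  focusing : HJ (suc a) → ∀ r s → ∃ λ n → ∀ (χ : Vec (Fin (suc (suc a))) n → Fin r) → MonoLine χ ⊎ Focused (suc a) s χ
  focusing hj r zero = 0 , λ χ → inj₂ record
    { focus = [] ; colour = λ () ; colour-inj = λ { {()} } ; line = λ () ; line-active = λ ()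
    ; line-focus = λ () ; line-colour = λ () ; focus-colour = λ () }
  focusing hj r (suc s) with focusing hj r s
  ... | n , P with hj (CodeSize (suc (suc a)) r n)
  ... | m , Q = m + n , λ χ →
    let L , act , mono = Q λ w → encode λ w′ → χ (map suc w ++ w′)
    in focus-step χ L act (λ x y → encode-injective _ _ (mono x y)) (P _)

hales-jewett-line : ∀ a → HJ (suc a)
hales-jewett-line zero    r = 1 , λ χ → nothing ∷ [] , here , λ { zero zero → refl }
hales-jewett-line (suc a) r with focusing (hales-jewett-line a) r (suc r)
... | n , P = n , λ χ → case P χ of λ where
  (inj₁ line) → line
  (inj₂ F)    → contradiction F focused-full

-- Parameter words and their composition

-- A k-parameter word of length n over a letters: once a parameter has occurred it is a further letter,
-- numbered zero, so that first occurrences are automatically in order.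
data PWord : ℕ → ℕ → ℕ → Set where
  ε      : PWord a 0 0
  letter : Fin a → PWord a k n → PWord a k (suc n)
  param  : PWord (suc a) k n → PWord a (suc k) (suc n)

act : (Fin a → X) → PWord a k n → Vec X k → Vec X n
act σ ε            []      = []
act σ (letter c W) u       = σ c ∷ act σ W u
act σ (param W)    (x ∷ u) = x ∷ act (x ▸ σ) W u

-- The letter map `σ` is there for the recursion: behind a parameter of `W` the alphabet of `W` has
-- grown, and `σ` records whether that parameter became a letter or a parameter of `v`.
plug : (Fin a → Fin b) → PWord a m n → PWord b k m → PWord b k n
plug σ ε            ε            = ε
plug σ (letter c W) v            = letter (σ c) (plug σ W v)
plug σ (param W)    (letter c v) = letter c (plug (c ▸ σ) W v)
plug σ (param W)    (param v)    = param (plug (zero ▸ suc ∘ σ) W v)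

infixr 9 _⊙_
_⊙_ : PWord a m n → PWord a k m → PWord a k n
_⊙_ = plug id

weaken : (Fin a → Fin b) → PWord a k n → PWord b k n
weaken ρ ε            = ε
weaken ρ (letter c W) = letter (ρ c) (weaken ρ W)
weaken ρ (param W)    = param (weaken (zero ▸ suc ∘ ρ) W)

act-cong : ∀ {σ τ : Fin a → X} → σ ≗ τ → (W : PWord a k n) → act σ W ≗ act τ W
act-cong σ≗τ ε            []      = refl
act-cong σ≗τ (letter c W) u       = cong₂ _∷_ (σ≗τ c) (act-cong σ≗τ W u)
act-cong σ≗τ (param W)    (x ∷ u) = cong (x ∷_) (act-cong (▸-cong x σ≗τ) W u)

plug-cong : ∀ {σ τ : Fin a → Fin b} → σ ≗ τ → (W : PWord a m n) (v : PWord b k m) → plug σ W v ≡ plug τ W v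
plug-cong σ≗τ ε            ε            = refl
plug-cong σ≗τ (letter c W) v            = cong₂ letter (σ≗τ c) (plug-cong σ≗τ W v)
plug-cong σ≗τ (param W)    (letter c v) = cong (letter c) (plug-cong (▸-cong c σ≗τ) W v)
plug-cong σ≗τ (param W)    (param v)    = cong param (plug-cong (▸-cong zero (cong suc ∘ σ≗τ)) W v)

▸-lift : ∀ (x : X) (τ : Fin b → X) (σ : Fin a → Fin b) → (x ▸ τ) ∘ (zero ▸ suc ∘ σ) ≗ x ▸ τ ∘ σ
▸-lift x τ σ = ∘-▸ (x ▸ τ) zero (suc ∘ σ)

act-plug : ∀ (τ : Fin b → X) (σ : Fin a → Fin b) (W : PWord a m n) (v : PWord b k m) u →
  act τ (plug σ W v) u ≡ act (τ ∘ σ) W (act τ v u)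
act-plug τ σ ε            ε            []      = refl
act-plug τ σ (letter c W) v            u       = cong (_ ∷_) (act-plug τ σ W v u)
act-plug τ σ (param W)    (letter c v) u       =
  cong (_ ∷_) (trans (act-plug τ (c ▸ σ) W v u) (act-cong (∘-▸ τ c σ) W _))
act-plug τ σ (param W)    (param v)    (x ∷ u) =
  cong (x ∷_) (trans (act-plug (x ▸ τ) (zero ▸ suc ∘ σ) W v u) (act-cong (▸-lift x τ σ) W _))

plug-plug : ∀ {c l} (τ : Fin b → Fin c) (σ : Fin a → Fin b) (U : PWord a m n) (V : PWord b l m) (v : PWord c k l) →
  plug τ (plug σ U V) v ≡ plug (τ ∘ σ) U (plug τ V v)
plug-plug τ σ ε            ε            ε            = refl
plug-plug τ σ (letter c U) V            v            = cong (letter _) (plug-plug τ σ U V v)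
plug-plug τ σ (param U)    (letter c V) v            =
  cong (letter _) (trans (plug-plug τ (c ▸ σ) U V v) (plug-cong (∘-▸ τ c σ) U _))
plug-plug τ σ (param U)    (param V)    (letter c v) =
  cong (letter c) (trans (plug-plug (c ▸ τ) (zero ▸ suc ∘ σ) U V v) (plug-cong (▸-lift c τ σ) U _))
plug-plug τ σ (param U)    (param V)    (param v)    =
  cong param (trans (plug-plug (zero ▸ suc ∘ τ) (zero ▸ suc ∘ σ) U V v)
    (plug-cong (λ i → trans (▸-lift zero (suc ∘ τ) σ i) (▸-cong zero (λ _ → refl) i)) U _))

⊙-assoc : ∀ {l} (U : PWord a m n) (V : PWord a l m) (v : PWord a k l) → (U ⊙ V) ⊙ v ≡ U ⊙ V ⊙ v
⊙-assoc = plug-plug id id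

act-weaken : ∀ (τ : Fin b → X) (ρ : Fin a → Fin b) (W : PWord a k n) u → act τ (weaken ρ W) u ≡ act (τ ∘ ρ) W u
act-weaken τ ρ ε            []      = refl
act-weaken τ ρ (letter c W) u       = cong (_ ∷_) (act-weaken τ ρ W u)
act-weaken τ ρ (param W)    (x ∷ u) =
  cong (x ∷_) (trans (act-weaken (x ▸ τ) (zero ▸ suc ∘ ρ) W u) (act-cong (▸-lift x τ ρ) W u))

plug-weaken : ∀ {c} (τ : Fin b → Fin c) (ρ : Fin a → Fin b) (W : PWord a m n) (v : PWord c k m) →
  plug τ (weaken ρ W) v ≡ plug (τ ∘ ρ) W v
plug-weaken τ ρ ε            ε            = refl
plug-weaken τ ρ (letter c W) v            = cong (letter _) (plug-weaken τ ρ W v)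
plug-weaken τ ρ (param W)    (letter c v) =
  cong (letter c) (trans (plug-weaken (c ▸ τ) (zero ▸ suc ∘ ρ) W v) (plug-cong (▸-lift c τ ρ) W v))
plug-weaken τ ρ (param W)    (param v)    =
  cong param (trans (plug-weaken (zero ▸ suc ∘ τ) (zero ▸ suc ∘ ρ) W v) (plug-cong (▸-lift zero (suc ∘ τ) ρ) W v))

toVec : PWord a 0 n → Vec (Fin a) n
toVec ε            = []
toVec (letter c W) = c ∷ toVec W

fromVec : Vec (Fin a) n → PWord a 0 n
fromVec []      = ε
fromVec (c ∷ w) = letter c (fromVec w)

fromVec-toVec : (v : PWord a 0 n) → fromVec (toVec v) ≡ v
fromVec-toVec ε            = refl
fromVec-toVec (letter c v) = cong (letter c) (fromVec-toVec v)

toVec-plug : ∀ (σ : Fin a → Fin b) (W : PWord a m n) v → toVec (plug σ W v) ≡ act σ W (toVec v)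
toVec-plug σ ε            ε            = refl
toVec-plug σ (letter c W) v            = cong (_ ∷_) (toVec-plug σ W v)
toVec-plug σ (param W)    (letter c v) = cong (c ∷_) (toVec-plug (c ▸ σ) W v)

-- The first variable position of a template opens the parameter, as `param` in `prepend`; the later
-- ones, treated here, refer back to it as the letter `zero`.
afterVar : Template (Fin a) m → PWord a k n → PWord (suc a) k (m + n)
afterVar []            W = weaken suc W
afterVar (just c ∷ L)  W = letter (suc c) (afterVar L W)
afterVar (nothing ∷ L) W = letter zero (afterVar L W)

prepend : (L : Template (Fin a) m) → Active L → PWord a k n → PWord a (suc k) (m + n)
prepend (nothing ∷ L) _         W = param (afterVar L W)
prepend (just c ∷ L)  (there v) W = letter c (prepend L v W)

act-afterVar : ∀ (L : Template (Fin a) m) (W : PWord a k n) x u →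
  act (x ▸ id) (afterVar L W) u ≡ fill L x ++ act id W u
act-afterVar []            W x u = act-weaken (x ▸ id) suc W u
act-afterVar (just c ∷ L)  W x u = cong (c ∷_) (act-afterVar L W x u)
act-afterVar (nothing ∷ L) W x u = cong (x ∷_) (act-afterVar L W x u)

act-prepend : ∀ (L : Template (Fin a) m) (v : Active L) (W : PWord a k n) x u →
  act id (prepend L v W) (x ∷ u) ≡ fill L x ++ act id W u
act-prepend (nothing ∷ L) _         W x u = cong (x ∷_) (act-afterVar L W x u)
act-prepend (just c ∷ L)  (there v) W x u = cong (c ∷_) (act-prepend L v W x u)

-- Colourings of the last `n` positions serve as colours of the first `l`. A line that is
-- monochromatic for them becomes the first parameter, and the induction hypothesis supplies the
-- others in the tail.
hales-jewett : ∀ a m r → ∃ λ n → ∀ (χ : Vec (Fin (suc a)) n → Fin r) →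
  Σ (PWord (suc a) m n) λ W → ∀ u v → χ (act id W u) ≡ χ (act id W v)
hales-jewett a zero    r = 0 , λ χ → ε , λ { [] [] → refl }
hales-jewett a (suc m) r with hales-jewett a m r
... | n , P with hales-jewett-line a (CodeSize (suc a) r n)
... | l , Q = l + n , λ χ →
  let L , var , mono = Q λ w → encode λ w′ → χ (w ++ w′)
      W , const      = P λ w → χ (fill L zero ++ w)
      χ-prepend : ∀ x u → χ (act id (prepend L var W) (x ∷ u)) ≡ χ (fill L zero ++ act id W u)
      χ-prepend x u = trans (cong χ (act-prepend L var W x u)) (encode-injective (λ w → χ (fill L x ++ w)) (λ w → χ (fill L zero ++ w)) (mono x zero) _)
  in prepend L var W , λ { (x ∷ u) (y ∷ v) →
       trans (χ-prepend x u) (trans (const u v) (sym (χ-prepend y v))) }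

-- The Graham–Rothschild theorem

prefix : PWord a (suc k) n → List (Fin a)
prefix (letter c v) = c ∷ˡ prefix v
prefix (param v)    = []ˡ

-- The part of W with its parameters replaced by l that precedes the first parameter not covered by l.
actˡ : (Fin a → X) → PWord a k n → List X → List X
actˡ σ ε            l        = []ˡ
actˡ σ (letter c W) l        = σ c ∷ˡ actˡ σ W l
actˡ σ (param W)    []ˡ      = []ˡ
actˡ σ (param W)    (x ∷ˡ l) = x ∷ˡ actˡ (x ▸ σ) W l

actˡ-cong : ∀ {σ τ : Fin a → X} → σ ≗ τ → (W : PWord a k n) → actˡ σ W ≗ actˡ τ W
actˡ-cong σ≗τ ε            l        = refl
actˡ-cong σ≗τ (letter c W) l        = cong₂ _∷ˡ_ (σ≗τ c) (actˡ-cong σ≗τ W l)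
actˡ-cong σ≗τ (param W)    []ˡ      = refl
actˡ-cong σ≗τ (param W)    (x ∷ˡ l) = cong (x ∷ˡ_) (actˡ-cong (▸-cong x σ≗τ) W l)

actˡ-plug : ∀ (τ : Fin b → X) (σ : Fin a → Fin b) (W : PWord a m n) (v : PWord b k m) l →
  actˡ τ (plug σ W v) l ≡ actˡ (τ ∘ σ) W (actˡ τ v l)
actˡ-plug τ σ ε            ε            l        = refl
actˡ-plug τ σ (letter c W) v            l        = cong (_ ∷ˡ_) (actˡ-plug τ σ W v l)
actˡ-plug τ σ (param W)    (letter c v) l        =
  cong (_ ∷ˡ_) (trans (actˡ-plug τ (c ▸ σ) W v l) (actˡ-cong (∘-▸ τ c σ) W _))
actˡ-plug τ σ (param W)    (param v)    []ˡ      = refl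
actˡ-plug τ σ (param W)    (param v)    (x ∷ˡ l) =
  cong (x ∷ˡ_) (trans (actˡ-plug (x ▸ τ) (zero ▸ suc ∘ σ) W v l) (actˡ-cong (▸-lift x τ σ) W _))

prefix-plug : ∀ (σ : Fin a → Fin b) (W : PWord a m n) (v : PWord b (suc k) m) →
  prefix (plug σ W v) ≡ actˡ σ W (prefix v)
prefix-plug σ (letter c W) v            = cong (_ ∷ˡ_) (prefix-plug σ W v)
prefix-plug σ (param W)    (letter c v) = cong (c ∷ˡ_) (prefix-plug (c ▸ σ) W v)
prefix-plug σ (param W)    (param v)    = refl

length-prefix : (v : PWord a (suc k) n) → length (prefix v) < n
length-prefix (letter c v) = s≤s (length-prefix v)
length-prefix (param v)    = s≤s z≤n

length-actˡ : ∀ (σ : Fin a → X) (W : PWord a k n) l → length (actˡ σ W l) ≤ n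
length-actˡ σ ε            l        = z≤n
length-actˡ σ (letter c W) l        = s≤s (length-actˡ σ W l)
length-actˡ σ (param W)    []ˡ      = z≤n
length-actˡ σ (param W)    (x ∷ˡ l) = s≤s (length-actˡ (x ▸ σ) W l)

actˡ-toList : ∀ (σ : Fin a → X) (W : PWord a k n) u → actˡ σ W (toList u) ≡ toList (act σ W u)
actˡ-toList σ ε            []      = refl
actˡ-toList σ (letter c W) u       = cong (_ ∷ˡ_) (actˡ-toList σ W u)
actˡ-toList σ (param W)    (x ∷ u) = cong (x ∷ˡ_) (actˡ-toList (x ▸ σ) W u)

snocParam : PWord a k n → PWord a (suc k) (suc n)
snocParam ε            = param ε
snocParam (letter c W) = letter c (snocParam W)
snocParam (param W)    = param (snocParam W)

actˡ-snocParam : ∀ (σ : Fin a → X) (W : PWord a k n) l → length l ≤ k → actˡ σ (snocParam W) l ≡ actˡ σ W l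
actˡ-snocParam σ ε            []ˡ      _         = refl
actˡ-snocParam σ (letter c W) l        l≤k       = cong (_ ∷ˡ_) (actˡ-snocParam σ W l l≤k)
actˡ-snocParam σ (param W)    []ˡ      _         = refl
actˡ-snocParam σ (param W)    (x ∷ˡ l) (s≤s l≤k) = cong (x ∷ˡ_) (actˡ-snocParam (x ▸ σ) W l l≤k)

vecOf : (l : List X) → length l ≡ n → ∃ λ (u : Vec X n) → toList u ≡ l
vecOf []ˡ      refl = [] , refl
vecOf (x ∷ˡ l) refl = let u , eq = vecOf l refl in x ∷ u , cong (x ∷ˡ_) eq

-- `V` makes all full substitutions of length `suc m` alike. The induction hypothesis is applied
-- behind `V`, and its word `W` gets one final parameter; `V` has `suc m′` parameters to make room
-- for it. Shorter lists stop before that final parameter at the latest, so they behave as they did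
-- under `W`.
length-homogeneous : ∀ a m r → ∃ λ n → ∀ (h : List (Fin (suc a)) → Fin r) →
  Σ (PWord (suc a) m n) λ W → Σ (ℕ → Fin r) λ colour →
    ∀ l → length l ≤ m → h (actˡ id W l) ≡ colour (length l)
length-homogeneous a zero    r = 0 , λ h → ε , (λ _ → h []ˡ) , λ { []ˡ z≤n → refl }
length-homogeneous a (suc m) r with length-homogeneous a m r
... | m′ , P with hales-jewett a (suc m′) r
... | n , Q = n , λ h →
  let V , const      = Q (h ∘ toList)
      W , colour , p = P (h ∘ actˡ id V)
      W⁺             = snocParam W

      full : ∀ u → h (actˡ id (V ⊙ W⁺) (toList u)) ≡ h (toList (act id V (replicate _ zero)))
      full u = trans (cong h (trans (actˡ-toList id (V ⊙ W⁺) u)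
                 (cong toList (act-plug id id V W⁺ u)))) (const _ _)

      short : ∀ l → length l ≤ m → h (actˡ id (V ⊙ W⁺) l) ≡ colour (length l)
      short l l≤m = trans (cong h (trans (actˡ-plug id id V W⁺ l)
                      (cong (actˡ id V) (actˡ-snocParam id W l l≤m)))) (p l l≤m)
  in V ⊙ W⁺ , (λ i → colour⁺ colour (h (toList (act id V (replicate _ zero)))) i (i ≤? m))
   , λ l l≤ → lemma h (V ⊙ W⁺) colour _ full short l l≤ (length l ≤? m)
  where
  colour⁺ : (ℕ → Fin r) → Fin r → ∀ i → Dec (i ≤ m) → Fin r
  colour⁺ colour c i (yes _) = colour i
  colour⁺ colour c i (no _)  = c

  lemma : ∀ {n} (h : List (Fin (suc a)) → Fin r) (W : PWord (suc a) (suc m) n) colour c →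
    (∀ (u : Vec _ (suc m)) → h (actˡ id W (toList u)) ≡ c) →
    (∀ l → length l ≤ m → h (actˡ id W l) ≡ colour (length l)) →
    ∀ l → length l ≤ suc m → (d : Dec (length l ≤ m)) → h (actˡ id W l) ≡ colour⁺ colour c (length l) d
  lemma h W colour c full short l l≤ (yes l≤m) = short l l≤m
  lemma h W colour c full short l l≤ (no l≰m)
    with u , refl ← vecOf l (≤-antisym l≤ (≰⇒> l≰m)) = full u

sum-decrement : ∀ (needs : Fin r → ℕ) c {q} → needs c ≡ suc q →
  sum needs ≡ suc (sum (updateAt needs c (λ _ → q)))
sum-decrement needs zero    eq = cong (_+ sum (needs ∘ suc)) eq
sum-decrement needs (suc c) eq =
  trans (cong (needs zero +_) (sum-decrement (needs ∘ suc) c eq)) (+-suc _ _)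

sum≡0 : ∀ (needs : Fin r → ℕ) c → sum needs ≤ 0 → needs c ≡ 0
sum≡0 needs zero    le = n≤0⇒n≡0 (≤-trans (m≤m+n _ _) le)
sum≡0 needs (suc c) le = sum≡0 (needs ∘ suc) c (≤-trans (m≤n+m _ _) le)

zeros : PWord (suc a) 0 n
zeros {n = zero}  = ε
zeros {n = suc n} = letter zero zeros

-- Each parameter of the word first occurs at a position of colour c.
Opening : (ℕ → Fin r) → Fin r → ℕ → ℕ → ℕ → Set₁
Opening colour c a n q = Σ (PWord (suc a) q n) λ W →
  ∀ {X : Set} (σ : Fin (suc a) → X) l → length l < q → colour (length (actˡ σ W l)) ≡ c

-- Letting the demands vary with the colour drives the induction: a position lowers the demand of
-- its own colour by one, and a demand that has sunk to 0 is met by a word without parameters.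
-- Positions of other colours than `c` are filled with the letter `zero`. The colour `c` is chosen
-- before `a`, because the alphabet grows with each opened parameter.
opening-pigeonhole : ∀ n (colour : ℕ → Fin r) (needs : Fin r → ℕ) → sum needs ≤ n →
  Σ (Fin r) λ c → ∀ a → Opening colour c a n (needs c)
opening-pigeonhole zero colour needs le =
  c , λ a → subst (Opening colour c a 0) (sym (sum≡0 needs c le)) (ε , λ _ _ ())
  where c = colour 0
opening-pigeonhole {r} (suc n) colour needs le with needs (colour 0) in eq
... | zero  = colour 0 , λ a → subst (Opening colour (colour 0) a (suc n)) (sym eq) (zeros , λ _ _ ())
... | suc q with opening-pigeonhole n (colour ∘ suc) (updateAt needs (colour 0) (λ _ → q))
                   (s≤s⁻¹ (≤-trans (≤-reflexive (sym (sum-decrement needs (colour 0) eq))) le))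
... | c , P = c , Q
  where
  Q : ∀ a → Opening colour c a (suc n) (needs c)
  Q a with c ≟ colour 0
  ... | yes refl = subst (Opening colour c a (suc n)) (sym eq)
                     (param (proj₁ V) , λ where
                       σ []ˡ      _         → refl
                       σ (x ∷ˡ l) (s≤s l<q) → proj₂ V (x ▸ σ) l l<q)
    where V = subst (Opening (colour ∘ suc) c (suc a) n) (updateAt-updates (colour 0) needs) (P (suc a))
  ... | no c≢ = letter zero (proj₁ V) , proj₂ V
    where V = subst (Opening (colour ∘ suc) c a n) (updateAt-minimal c (colour 0) needs c≢) (P a)

-- `W` leaves only the length of the prefix to matter, and `V` opens its parameters only at lengths
-- of one colour. The prefix of `v` is shorter than `m`, so that of `V ⊙ v` ends where a parameter
-- of `V` opens. A demand of `m` openings for each of the `r` colours gives the sum.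
prefix-homogeneous : ∀ a m r → ∃ λ n → ∀ (h : List (Fin (suc a)) → Fin r) →
  Σ (PWord (suc a) m n) λ W → Σ (Fin r) λ c → ∀ {k} (v : PWord (suc a) (suc k) m) → h (prefix (W ⊙ v)) ≡ c
prefix-homogeneous a m r with length-homogeneous a (sum {r} (λ _ → m)) r
... | n , P = n , λ h →
  let W , colour , p = P h
      c , Q          = opening-pigeonhole (sum {r} (λ _ → m)) colour (λ _ → m) ≤-refl
      V , q          = Q a
  in W ⊙ V , c , λ v → begin
       h (prefix ((W ⊙ V) ⊙ v))             ≡⟨ cong h (prefix-plug id (W ⊙ V) v) ⟩
       h (actˡ id (W ⊙ V) (prefix v))       ≡⟨ cong h (actˡ-plug id id W V (prefix v)) ⟩
       h (actˡ id W (actˡ id V (prefix v))) ≡⟨ p _ (length-actˡ id V (prefix v)) ⟩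
       colour (length (actˡ id V (prefix v))) ≡⟨ q id (prefix v) (length-prefix v) ⟩
       c ∎
  where open ≡-Reasoning

-- The argument of type `Fin r` is a default colour, for the case that `m < k` leaves no word `v`
-- from which to take one.
GR : ℕ → Set
GR k = ∀ a m r → Fin r → ∃ λ n → ∀ (χ : PWord (suc a) k n → Fin r) →
  Σ (PWord (suc a) m n) λ W → Σ (Fin r) λ c → ∀ v → χ (W ⊙ v) ≡ c

-- Two kinds of `v` are treated apart. If `v` opens a parameter at once, the rest has `k` parameters
-- over one more letter, and `gr` makes the colour constant. If `v` starts with a letter, the
-- induction on `m` applies to the rest, with the tuple of colours for all possible first letters as
-- the new colour.
prefix-determined : GR k → ∀ a m r → Fin r → ∃ λ n → ∀ (χ : PWord (suc a) (suc k) n → Fin r) →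
  Σ (PWord (suc a) m n) λ W → Σ (List (Fin (suc a)) → Fin r) λ h → ∀ v → χ (W ⊙ v) ≡ h (prefix v)
prefix-determined gr a zero    r d = 0 , λ χ → ε , (λ _ → d) , λ ()
prefix-determined {k} gr a (suc m) r d with prefix-determined gr a m (r ^ suc a) (funToFin {suc a} (λ _ → d))
... | m′ , P with gr (suc a) m′ r d
... | n , Q = suc n , λ χ →
  let W₀ , c₀ , p₀ = Q (χ ∘ param)
      W₁           = param W₀
      W₂ , h , p₂  = P λ v → funToFin λ c → χ (W₁ ⊙ letter c v)
  -- `weaken suc W₂` ignores the newly opened parameter, so a first letter `c` affects only `W₁` and
  -- leaves `W₂ ⊙ v` intact.
  in W₁ ⊙ param (weaken suc W₂) , h⁺ c₀ h , λ v → trans (cong χ (⊙-assoc W₁ _ v)) (lemma χ W₀ c₀ p₀ W₂ h p₂ v)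
  where
  h⁺ : Fin r → (List (Fin (suc a)) → Fin (r ^ suc a)) → List (Fin (suc a)) → Fin r
  h⁺ c₀ h []ˡ      = c₀
  h⁺ c₀ h (c ∷ˡ l) = finToFun (h l) c

  lemma : ∀ {n} (χ : PWord (suc a) (suc k) (suc n) → Fin r) (W₀ : PWord (suc (suc a)) m′ n) c₀ →
    (∀ v → χ (param (W₀ ⊙ v)) ≡ c₀) → ∀ W₂ h →
    (∀ v → funToFin (λ c → χ (param W₀ ⊙ letter c (W₂ ⊙ v))) ≡ h (prefix v)) →
    ∀ (v : PWord (suc a) (suc k) (suc m)) → χ (param W₀ ⊙ param (weaken suc W₂) ⊙ v) ≡ h⁺ c₀ h (prefix v)
  lemma χ W₀ c₀ p₀ W₂ h p₂ (letter c v) = begin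
    χ (param W₀ ⊙ letter c (plug (c ▸ id) (weaken suc W₂) v))
      ≡⟨ cong (λ w → χ (param W₀ ⊙ letter c w)) (plug-weaken (c ▸ id) suc W₂ v) ⟩
    χ (param W₀ ⊙ letter c (W₂ ⊙ v))
      ≡⟨ finToFun-funToFin (λ c → χ (param W₀ ⊙ letter c (W₂ ⊙ v))) c ⟨
    finToFun (funToFin (λ c → χ (param W₀ ⊙ letter c (W₂ ⊙ v)))) c
      ≡⟨ cong (λ f → finToFun f c) (p₂ v) ⟩
    finToFun (h (prefix v)) c ∎
    where open ≡-Reasoning
  lemma χ W₀ c₀ p₀ W₂ h p₂ (param v) =
    trans (cong (χ ∘ param) (plug-cong (λ { zero → refl ; (suc _) → refl }) W₀ _)) (p₀ _)

graham-rothschild : ∀ k → GR k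
graham-rothschild zero a m r d with hales-jewett a m r
... | n , P = n , λ χ →
  let W , const = P (χ ∘ fromVec)
  in W , χ (fromVec (act id W (replicate _ zero))) , λ v →
       trans (cong χ (trans (sym (fromVec-toVec (W ⊙ v))) (cong fromVec (toVec-plug id W v)))) (const _ _)
graham-rothschild (suc k) a m r d with prefix-homogeneous a m r
... | m′ , P with prefix-determined (graham-rothschild k) a m′ r d
... | n , Q = n , λ χ →
  let W , h , p = Q χ
      V , c , q = P h
  in W ⊙ V , c , λ v → trans (cong χ (⊙-assoc W V v)) (trans (p (V ⊙ v)) (q v))

-- Structures of 𝒮* in normal form

<⇒<ᵇ≡true : m < n → (m <ᵇ n) ≡ true
<⇒<ᵇ≡true {m} {n} = dec-true (m <? n)

≮⇒<ᵇ≡false : ¬ m < n → (m <ᵇ n) ≡ false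
≮⇒<ᵇ≡false {m} {n} = dec-false (m <? n)

<ᵇ≡true⇒< : (m <ᵇ n) ≡ true → m < n
<ᵇ≡true⇒< {m} {n} eq with m <? n
... | yes m<n = m<n
... | no  m≮n = case trans (sym eq) (≮⇒<ᵇ≡false m≮n) of λ ()

StrictMono : (Fin m → Fin n) → Set
StrictMono f = ∀ {x y} → toℕ x < toℕ y → toℕ (f x) < toℕ (f y)

module _ {f : Fin m → Fin n} (f-mono : StrictMono f) where

  strictMono-reflects : ∀ {x y} → toℕ (f x) < toℕ (f y) → toℕ x < toℕ y
  strictMono-reflects {x} {y} fx<fy with <-cmp (toℕ x) (toℕ y)
  ... | tri< x<y _ _ = x<y
  ... | tri≈ _ x≡y _ = contradiction fx<fy (λ lt → n≮n _ (subst (λ z → toℕ (f z) < toℕ (f y)) (toℕ-injective x≡y) lt))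
  ... | tri> _ _ y<x = contradiction (<⇒≤ fx<fy) (<⇒≱ (f-mono y<x))

  strictMono-<ᵇ : ∀ x y → (toℕ x <ᵇ toℕ y) ≡ (toℕ (f x) <ᵇ toℕ (f y))
  strictMono-<ᵇ x y with toℕ x <? toℕ y
  ... | yes x<y = trans (<⇒<ᵇ≡true x<y) (sym (<⇒<ᵇ≡true (f-mono x<y)))
  ... | no  x≮y = trans (≮⇒<ᵇ≡false x≮y) (sym (≮⇒<ᵇ≡false (x≮y ∘ strictMono-reflects)))

  strictMono-injective : Injective _≡_ _≡_ f
  strictMono-injective {x} {y} eq with <-cmp (toℕ x) (toℕ y)
  ... | tri< x<y _ _ = contradiction eq (<⇒≢ (f-mono x<y))
  ... | tri≈ _ x≡y _ = toℕ-injective x≡y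
  ... | tri> _ _ y<x = contradiction (sym eq) (<⇒≢ (f-mono y<x))

-- The edge from `x` in part `i` to `u` in part `j`, where `s` says whether (t_i, u) is an edge and
-- `t` whether (t_j, x) is. The formula is the parity constraint for {x, t_i} and {u, t_j}, solved
-- for that edge.
orient : ℕ → ℕ → Bool → Bool → Bool
orient zero    zero    s t = false
orient zero    (suc j) s t = s xor t
orient (suc i) zero    s t = not (s xor t)
orient (suc i) (suc j) s t = orient i j s t

orient-< : ∀ {i j} → i < j → ∀ s t → orient i j s t ≡ s xor t
orient-< {zero}  {suc j} _         s t = refl
orient-< {suc i} {suc j} (s≤s i<j) s t = orient-< i<j s t

orient-> : ∀ {i j} → j < i → ∀ s t → orient i j s t ≡ not (s xor t)
orient-> {suc i} {zero}  _         s t = refl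
orient-> {suc i} {suc j} (s≤s j<i) s t = orient-> j<i s t

orient-refl : ∀ i s t → orient i i s t ≡ false
orient-refl zero    s t = refl
orient-refl (suc i) s t = orient-refl i s t

orient-strictMono : ∀ {φ : Fin m → Fin n} → StrictMono φ → ∀ i j s t →
  orient (toℕ i) (toℕ j) s t ≡ orient (toℕ (φ i)) (toℕ (φ j)) s t
orient-strictMono {φ = φ} φ-mono i j s t with <-cmp (toℕ i) (toℕ j)
... | tri< i<j _ _ = trans (orient-< i<j s t) (sym (orient-< (φ-mono i<j) s t))
... | tri> _ _ j<i = trans (orient-> j<i s t) (sym (orient-> (φ-mono j<i) s t))
... | tri≈ _ i≡j _ with refl ← toℕ-injective i≡j =
  trans (orient-refl (toℕ i) s t) (sym (orient-refl (toℕ (φ i)) s t))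

orient-asym : ∀ i j s t → orient i j s t ≡ true → orient j i t s ≡ false
orient-asym zero    zero    s     t     ()
orient-asym zero    (suc j) true  false _ = refl
orient-asym zero    (suc j) false true  _ = refl
orient-asym (suc i) zero    true  true  _ = refl
orient-asym (suc i) zero    false false _ = refl
orient-asym (suc i) (suc j) s     t     eq = orient-asym i j s t eq

orient-total : ∀ i j s t → orient i j s t ≡ false → orient j i t s ≡ false → i ≡ j
orient-total zero    zero    s     t     _  _  = refl
orient-total zero    (suc j) true  true  _  ()
orient-total zero    (suc j) false false _  ()
orient-total (suc i) zero    true  false _  ()
orient-total (suc i) zero    false true  _  ()
orient-total (suc i) (suc j) s     t     eq eq′ = cong suc (orient-total i j s t eq eq′)

-- Modulo 2, each of `s`, `s′`, `t`, `t′` enters two of the four terms, and the negations for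
-- `j < i` contribute 4.
orient-parity : ∀ i j s s′ t t′ → i ≢ j →
  2 ∣ b2n (orient i j s t) + b2n (orient i j s′ t) + b2n (orient i j s t′) + b2n (orient i j s′ t′)
orient-parity zero    zero    s     s′    t     t′    i≢j = contradiction refl i≢j
orient-parity zero    (suc j) true  true  true  true  _   = divides 0 refl
orient-parity zero    (suc j) true  true  true  false _   = divides 1 refl
orient-parity zero    (suc j) true  true  false true  _   = divides 1 refl
orient-parity zero    (suc j) true  true  false false _   = divides 2 refl
orient-parity zero    (suc j) true  false true  true  _   = divides 1 refl
orient-parity zero    (suc j) true  false true  false _   = divides 1 refl
orient-parity zero    (suc j) true  false false true  _   = divides 1 refl
orient-parity zero    (suc j) true  false false false _   = divides 1 refl
orient-parity zero    (suc j) false true  true  true  _   = divides 1 refl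
orient-parity zero    (suc j) false true  true  false _   = divides 1 refl
orient-parity zero    (suc j) false true  false true  _   = divides 1 refl
orient-parity zero    (suc j) false true  false false _   = divides 1 refl
orient-parity zero    (suc j) false false true  true  _   = divides 2 refl
orient-parity zero    (suc j) false false true  false _   = divides 1 refl
orient-parity zero    (suc j) false false false true  _   = divides 1 refl
orient-parity zero    (suc j) false false false false _   = divides 0 refl
orient-parity (suc i) zero    true  true  true  true  _   = divides 2 refl
orient-parity (suc i) zero    true  true  true  false _   = divides 1 refl
orient-parity (suc i) zero    true  true  false true  _   = divides 1 refl
orient-parity (suc i) zero    true  true  false false _   = divides 0 refl
orient-parity (suc i) zero    true  false true  true  _   = divides 1 refl
orient-parity (suc i) zero    true  false true  false _   = divides 1 refl
orient-parity (suc i) zero    true  false false true  _   = divides 1 refl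
orient-parity (suc i) zero    true  false false false _   = divides 1 refl
orient-parity (suc i) zero    false true  true  true  _   = divides 1 refl
orient-parity (suc i) zero    false true  true  false _   = divides 1 refl
orient-parity (suc i) zero    false true  false true  _   = divides 1 refl
orient-parity (suc i) zero    false true  false false _   = divides 1 refl
orient-parity (suc i) zero    false false true  true  _   = divides 0 refl
orient-parity (suc i) zero    false false true  false _   = divides 1 refl
orient-parity (suc i) zero    false false false true  _   = divides 1 refl
orient-parity (suc i) zero    false false false false _   = divides 2 refl
orient-parity (suc i) (suc j) s     s′    t     t′    i≢j = orient-parity i j s s′ t t′ (i≢j ∘ cong suc)

edge : (Fin n → Fin k) → (Fin k → Fin n → Bool) → Rel₂ n
edge p l x u = orient (toℕ (p x)) (toℕ (p u)) (l (p x) u) (l (p u) x)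

module _ (p : Fin n → Fin k) (l : Fin k → Fin n → Bool) where

  edge-same : ∀ {x u} → p x ≡ p u → edge p l x u ≡ false
  edge-same {x} {u} eq rewrite eq = orient-refl (toℕ (p u)) _ _

  edge-perp : ∀ x u → Perp (edge p l) x u ⟺ (p x ≡ p u)
  edge-perp x u = (λ { (xu , ux) → toℕ-injective (orient-total (toℕ (p x)) _ _ _ xu ux) })
                , (λ eq → edge-same eq , edge-same (sym eq))

  edge-InS : InS (edge p l)
  edge-InS =
      ((λ x → edge-same refl) , λ x u → orient-asym (toℕ (p x)) _ _ _)
    , record { refl  = λ {x} → proj₂ (edge-perp x x) refl
             ; sym   = λ (xy , yx) → yx , xy
             ; trans = λ {x} {y} {z} xy yz → proj₂ (edge-perp x z)
                 (trans (proj₁ (edge-perp x y) xy) (proj₁ (edge-perp y z) yz)) }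
    , parity
    where
    parity : ∀ u v x y → Perp (edge p l) u v → Perp (edge p l) x y → ¬ Perp (edge p l) u x →
      u ≢ v → x ≢ y → 2 ∣ edgesFromTo (edge p l) u v x y
    parity u v x y uv xy ¬ux _ _
      rewrite sym (proj₁ (edge-perp u v) uv) | sym (proj₁ (edge-perp x y) xy) =
      orient-parity (toℕ (p u)) (toℕ (p x)) _ _ _ _ (¬ux ∘ proj₂ (edge-perp u x) ∘ toℕ-injective)

  edge-KPartite : (∀ i → ∃[ x ] p x ≡ i) → KPartite (edge p l) k
  edge-KPartite surj = p , (λ i → proj₁ (surj i) , λ { refl → proj₂ (surj i) }) , edge-perp

-- The vertices are listed in increasing order, p gives the part of a vertex, and l i u tells whether
-- (t_i, u) is an edge of Ā.
record Normal : Set where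
  field
    #v #p  : ℕ
    p      : Fin #v → Fin #p
    p-surj : ∀ i → ∃[ x ] p x ≡ i
    p-mono : ∀ {x y} → toℕ x ≤ toℕ y → toℕ (p x) ≤ toℕ (p y)
    l      : Fin #p → Fin #v → Bool
    l-own  : ∀ x → l (p x) x ≡ false

  structure : Str
  structure = record
    { size = #v ; E = edge p l ; R = λ x u → l (p x) u ; L = λ x y → toℕ x <ᵇ toℕ y }

combine-monoʳ-< : ∀ (i : Fin m) {x y : Fin n} → toℕ x < toℕ y → toℕ (combine i x) < toℕ (combine i y)
combine-monoʳ-< i {x} {y} x<y rewrite toℕ-combine i x | toℕ-combine i y = +-monoʳ-< _ x<y

combine-reflects-≤ : ∀ (i j : Fin m) (x y : Fin n) → toℕ (combine i x) < toℕ (combine j y) → toℕ i ≤ toℕ j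
combine-reflects-≤ i j x y lt = ≮⇒≥ λ j<i → <⇒≱ (combine-monoˡ-< y x j<i) (<⇒≤ lt)

<ᵇ-IsStrictLinear : ∀ (f : Fin n → Fin m) → Injective _≡_ _≡_ f → IsStrictLinear (λ x y → toℕ (f x) <ᵇ toℕ (f y))
<ᵇ-IsStrictLinear f f-inj =
    (λ x → ≮⇒<ᵇ≡false (n≮n (toℕ (f x))))
  , (λ x y z x<y y<z → <⇒<ᵇ≡true (<-trans {toℕ (f x)} (<ᵇ≡true⇒< x<y) (<ᵇ≡true⇒< {_} {toℕ (f z)} y<z)))
  , λ x y x≢y → case <-cmp (toℕ (f x)) (toℕ (f y)) of λ where
      (tri< x<y _ _) → inj₁ (<⇒<ᵇ≡true x<y)
      (tri≈ _ x≡y _) → contradiction (f-inj (toℕ-injective x≡y)) x≢y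
      (tri> _ _ y<x) → inj₂ (<⇒<ᵇ≡true y<x)

module _ (N : Normal) where
  open Normal N

  private
    p̄ : Fin (#v + #p) → Fin #p
    p̄ w = [ p , id ]′ (splitAt #v w)

    -- The entries of l̄ at t_j are forced by the requirement that (t_i, t_j) be an edge iff i < j.
    l̄ : Fin #p → Fin (#v + #p) → Bool
    l̄ i w = [ l i , (λ j → toℕ i <ᵇ toℕ j) ]′ (splitAt #v w)

    p̄-a : ∀ x → p̄ (x ↑ˡ #p) ≡ p x
    p̄-a x = cong [ p , id ]′ (splitAt-↑ˡ #v x #p)

    p̄-t : ∀ i → p̄ (#v ↑ʳ i) ≡ i
    p̄-t i = cong [ p , id ]′ (splitAt-↑ʳ #v #p i)

    l̄-a : ∀ i x → l̄ i (x ↑ˡ #p) ≡ l i x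
    l̄-a i x = cong [ l i , _ ]′ (splitAt-↑ˡ #v x #p)

    l̄-t : ∀ i j → l̄ i (#v ↑ʳ j) ≡ (toℕ i <ᵇ toℕ j)
    l̄-t i j = cong [ l i , _ ]′ (splitAt-↑ʳ #v #p j)

    Ē : Rel₂ (#v + #p)
    Ē = edge p̄ l̄

    Ē-aa : ∀ x y → Ē (x ↑ˡ #p) (y ↑ˡ #p) ≡ edge p l x y
    Ē-aa x y rewrite p̄-a x | p̄-a y | l̄-a (p x) y | l̄-a (p y) x = refl

    Ē-ta : ∀ i u → i ≢ p u → Ē (#v ↑ʳ i) (u ↑ˡ #p) ≡ l i u
    Ē-ta i u i≢ rewrite p̄-t i | p̄-a u | l̄-a i u | l̄-t (p u) i with <-cmp (toℕ i) (toℕ (p u))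
    ... | tri≈ _ eq _ = contradiction (toℕ-injective eq) i≢
    ... | tri< lt _ ≯ rewrite ≮⇒<ᵇ≡false ≯ = trans (orient-< lt _ _) (xor-false (l i u))
      where
      xor-false : ∀ b → b xor false ≡ b
      xor-false true  = refl
      xor-false false = refl
    ... | tri> _ _ gt rewrite <⇒<ᵇ≡true gt = trans (orient-> gt _ _) (not-xor-true (l i u))
      where
      not-xor-true : ∀ b → not (b xor true) ≡ b
      not-xor-true true  = refl
      not-xor-true false = refl

    Ē-tt : ∀ i j → toℕ i < toℕ j → Ē (#v ↑ʳ i) (#v ↑ʳ j) ≡ true
    Ē-tt i j i<j rewrite p̄-t i | p̄-t j | l̄-t i j | l̄-t j i
      | <⇒<ᵇ≡true i<j | ≮⇒<ᵇ≡false (λ j<i → <⇒≱ i<j (<⇒≤ j<i)) = orient-< i<j true false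

    -- The order on the extended universe goes by part first; inside a part the old vertices keep
    -- their order and the added vertex comes last.
    key : Fin (#v + #p) → Fin (#p * (#v + #p))
    key w = combine (p̄ w) w

    key-a-mono : StrictMono (λ x → key (x ↑ˡ #p))
    key-a-mono {x} {y} x<y rewrite p̄-a x | p̄-a y with <-cmp (toℕ (p x)) (toℕ (p y))
    ... | tri< lt _ _ = combine-monoˡ-< _ _ lt
    ... | tri> _ _ gt = contradiction (p-mono (<⇒≤ x<y)) (<⇒≱ gt)
    ... | tri≈ _ eq _ rewrite toℕ-injective eq = combine-monoʳ-< (p y) a<a
      where
      a<a : toℕ (x ↑ˡ #p) < toℕ (y ↑ˡ #p)
      a<a rewrite toℕ-↑ˡ x #p | toℕ-↑ˡ y #p = x<y

  normal∈𝒮* : InSStar structure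
  normal∈𝒮* =
      #p
    , edge-InS p l
    , edge-KPartite p l p-surj
    , Ē
    , edge-InS p̄ l̄
    , edge-KPartite p̄ l̄ (λ i → #v ↑ʳ i , p̄-t i)
    , Ē-aa
    , (λ w → p̄ w , proj₂ (edge-perp p̄ l̄ w _) (sym (p̄-t (p̄ w))))
    , (λ i j perp → trans (sym (p̄-t i)) (trans (proj₁ (edge-perp p̄ l̄ _ _) perp) (p̄-t j)))
    , Ē-tt
    , R-spec
    , (λ w w′ → toℕ (key w) <ᵇ toℕ (key w′))
    , <ᵇ-IsStrictLinear key (λ {w} {w′} eq → combine-injectiveʳ (p̄ w) w (p̄ w′) w′ eq)
    , t-increasing
    , convex
    , strictMono-<ᵇ key-a-mono
    where
    R-spec : ∀ x u → (l (p x) u ≡ true) ⟺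
      (¬ Perp (edge p l) x u × ∃[ i ] (Perp Ē (x ↑ˡ #p) (#v ↑ʳ i) × Ē (#v ↑ʳ i) (u ↑ˡ #p) ≡ true))
    proj₁ (R-spec x u) eq =
        px≢pu ∘ proj₁ (edge-perp p l x u)
      , p x , proj₂ (edge-perp p̄ l̄ _ _) (trans (p̄-a x) (sym (p̄-t (p x))))
      , trans (Ē-ta (p x) u px≢pu) eq
      where
      px≢pu : p x ≢ p u
      px≢pu px≡pu with () ← trans (sym eq) (trans (cong (λ i → l i u) px≡pu) (l-own u))
    proj₂ (R-spec x u) (¬perp , i , perp , ti→u)
      with refl ← trans (sym (p̄-a x)) (trans (proj₁ (edge-perp p̄ l̄ _ _) perp) (p̄-t i)) =
      trans (sym (Ē-ta (p x) u (¬perp ∘ proj₂ (edge-perp p l x u)))) ti→u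

    t-increasing : ∀ i j → toℕ i < toℕ j → (toℕ (key (#v ↑ʳ i)) <ᵇ toℕ (key (#v ↑ʳ j))) ≡ true
    t-increasing i j i<j rewrite p̄-t i | p̄-t j = <⇒<ᵇ≡true (combine-monoˡ-< _ _ i<j)

    convex : ∀ w₁ w₂ w₃ → (toℕ (key w₁) <ᵇ toℕ (key w₂)) ≡ true → (toℕ (key w₂) <ᵇ toℕ (key w₃)) ≡ true →
      Perp Ē w₁ w₃ → Perp Ē w₁ w₂
    convex w₁ w₂ w₃ lt₁ lt₂ perp = proj₂ (edge-perp p̄ l̄ w₁ w₂) (toℕ-injective (≤-antisym
      (combine-reflects-≤ (p̄ w₁) (p̄ w₂) w₁ w₂ (<ᵇ≡true⇒< lt₁))
      (≤-trans (combine-reflects-≤ (p̄ w₂) (p̄ w₃) w₂ w₃ (<ᵇ≡true⇒< lt₂))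
               (≤-reflexive (cong toℕ (sym (proj₁ (edge-perp p̄ l̄ w₁ w₃) perp)))))))

module _ (N N′ : Normal) where
  private
    module N  = Normal N
    module N′ = Normal N′

  normalEmb : (f : Fin N.#v → Fin N′.#v) (φ : Fin N.#p → Fin N′.#p) → StrictMono f → StrictMono φ →
    (∀ x → N′.p (f x) ≡ φ (N.p x)) → (∀ i u → N′.l (φ i) (f u) ≡ N.l i u) → Emb N.structure N′.structure
  normalEmb f φ f-mono φ-mono f-p f-l = record
    { fun   = f
    ; inj   = strictMono-injective f-mono
    ; presE = λ x y → trans (orient-strictMono φ-mono (N.p x) (N.p y) _ _) (presE′ x y)
    ; presR = λ x y → sym (trans (cong (λ i → N′.l i (f y)) (f-p x)) (f-l (N.p x) y))
    ; presL = strictMono-<ᵇ f-mono }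
    where
    presE′ : ∀ x y → orient (toℕ (φ (N.p x))) (toℕ (φ (N.p y))) (N.l (N.p x) y) (N.l (N.p y) x)
                   ≡ edge N′.p N′.l (f x) (f y)
    presE′ x y rewrite f-p x | f-p y | f-l (N.p x) y | f-l (N.p y) x = refl

-- Reduction to normal forms

injective⇒surjective : ∀ {f : Fin n → Fin n} → Injective _≡_ _≡_ f → ∀ y → ∃[ x ] f x ≡ y
injective⇒surjective {suc n} {f} f-inj y with any? (λ x → f x ≟ y)
... | yes hit = hit
... | no miss = contradiction (injective⇒≤ {f = λ x → punchOut (y≢f x)}
                  (λ {x} {x′} → f-inj ∘ punchOut-injective (y≢f x) (y≢f x′))) (n≮n n)
  where
  y≢f : ∀ x → y ≢ f x
  y≢f x eq = miss (x , sym eq)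

∈-tabulate⁺ : ∀ (f : Fin n → Bool) {x} → f x ≡ true → x ∈ tabulate f
∈-tabulate⁺ f {x} eq = lookup⇒[]= x _ (trans (lookup∘tabulate f x) eq)

∈-tabulate⁻ : ∀ (f : Fin n → Bool) {x} → x ∈ tabulate f → f x ≡ true
∈-tabulate⁻ f {x} x∈ = trans (sym (lookup∘tabulate f x)) ([]=⇒lookup x∈)

module Rank {lt : Rel₂ n} (linear : IsStrictLinear lt) where

  private
    irrefl    = proj₁ linear
    transitive = proj₁ (proj₂ linear)
    total     = proj₂ (proj₂ linear)

    below : Fin n → Subset n
    below x = tabulate λ y → lt y x

    x∉below : ∀ x → ¬ x ∈ below x
    x∉below x x∈ with () ← trans (sym (irrefl x)) (∈-tabulate⁻ (λ y → lt y x) x∈)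

    ∣below∣<n : ∀ x → ∣ below x ∣ < n
    ∣below∣<n x = ≤-trans (p⊂q⇒∣p∣<∣q∣ (⊆⊤ , x , ∈⊤ , x∉below x)) (≤-reflexive (∣⊤∣≡n n))

  rank : Fin n → Fin n
  rank x = fromℕ< (∣below∣<n x)

  rank-< : ∀ {x y} → lt x y ≡ true → toℕ (rank x) < toℕ (rank y)
  rank-< {x} {y} x<y rewrite toℕ-fromℕ< (∣below∣<n x) | toℕ-fromℕ< (∣below∣<n y) =
    p⊂q⇒∣p∣<∣q∣ ( (λ {z} z∈ → ∈-tabulate⁺ (λ w → lt w y) (transitive z x y (∈-tabulate⁻ (λ w → lt w x) z∈) x<y))
                , x , ∈-tabulate⁺ (λ w → lt w y) x<y , x∉below x )

  rank-injective : Injective _≡_ _≡_ rank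
  rank-injective {x} {y} eq with x ≟ y
  ... | yes x≡y = x≡y
  ... | no  x≢y with total x y x≢y
  ...   | inj₁ x<y = contradiction eq (<⇒≢ (rank-< x<y))
  ...   | inj₂ y<x = contradiction (sym eq) (<⇒≢ (rank-< y<x))

  unrank : Fin n → Fin n
  unrank i = proj₁ (injective⇒surjective rank-injective i)

  rank-unrank : ∀ i → rank (unrank i) ≡ i
  rank-unrank i = proj₂ (injective⇒surjective rank-injective i)

  unrank-rank : ∀ x → unrank (rank x) ≡ x
  unrank-rank x = rank-injective (rank-unrank (rank x))

  unrank-lt : ∀ i j → (toℕ i <ᵇ toℕ j) ≡ lt (unrank i) (unrank j)
  unrank-lt i j with lt (unrank i) (unrank j) in eq
  ... | true  = <⇒<ᵇ≡true (subst₂ (λ a b → toℕ a < toℕ b) (rank-unrank i) (rank-unrank j) (rank-< eq))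
  ... | false = ≮⇒<ᵇ≡false i≮j
    where
    i≮j : ¬ toℕ i < toℕ j
    i≮j i<j with unrank i ≟ unrank j
    ... | yes same = <⇒≢ i<j (trans (sym (rank-unrank i)) (trans (cong rank same) (rank-unrank j)))
    ... | no  diff with total _ _ diff
    ...   | inj₁ lt≡true with () ← trans (sym eq) lt≡true
    ...   | inj₂ gt = <⇒≱ i<j (<⇒≤ (subst₂ (λ a b → toℕ a < toℕ b) (rank-unrank j) (rank-unrank i) (rank-< gt)))

NormalForm : Str → Set
NormalForm M = Σ Normal λ N → Σ (Emb (Normal.structure N) M) λ e → ∀ x → ∃[ y ] fun e y ≡ x

normalise : ∀ M → InSStar M → NormalForm M
normalise M (k , _ , (c , c-surj , c-perp) , Ē , (Ē-digraph , Ē-equiv , Ē-parity) , _ , Ē-aa , t-part , t-sep , Ē-tt ,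
             R-spec , lt , (lt-irrefl , lt-trans , lt-total) , lt-tt , lt-convex , L-spec) =
  N , record { fun = unrank ; inj = λ {i} {j} eq → trans (sym (rank-unrank i)) (trans (cong rank eq) (rank-unrank j))
             ; presE = λ i j → sym (E≡edge (unrank i) (unrank j))
             ; presR = λ i j → sym (R≡l (unrank i) (unrank j))
             ; presL = unrank-lt }
    , λ x → rank x , unrank-rank x
  where
  v = size M
  module ≈ = IsEquivalence Ē-equiv

  α : Fin v → Fin (v + k)
  α x = x ↑ˡ k

  t : Fin k → Fin (v + k)
  t i = v ↑ʳ i

  a≢t : ∀ x i → α x ≢ t i
  a≢t x i eq with () ← trans (sym (splitAt-↑ˡ v x k)) (trans (cong (splitAt v) eq) (splitAt-↑ʳ v k i))

  p : Fin v → Fin k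
  p x = proj₁ (t-part (α x))

  x⊥t : ∀ x → Perp Ē (α x) (t (p x))
  x⊥t x = proj₂ (t-part (α x))

  perp⇒p : ∀ {x y} → Perp Ē (α x) (α y) → p x ≡ p y
  perp⇒p {x} {y} perp = t-sep _ _ (≈.trans (≈.sym (x⊥t x)) (≈.trans perp (x⊥t y)))

  p⇒perp : ∀ {x y} → p x ≡ p y → Perp Ē (α x) (α y)
  p⇒perp {x} {y} eq = ≈.trans (x⊥t x) (≈.trans (subst (λ i → Perp Ē (t (p x)) (t i)) eq ≈.refl) (≈.sym (x⊥t y)))

  perp-aa : ∀ {x y} → Perp (E M) x y ⟺ Perp Ē (α x) (α y)
  perp-aa {x} {y} = (λ (xy , yx) → trans (Ē-aa x y) xy , trans (Ē-aa y x) yx)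
                  , (λ (xy , yx) → trans (sym (Ē-aa x y)) xy , trans (sym (Ē-aa y x)) yx)

  representative : Fin k → Fin v
  representative i = proj₁ (c-surj i)

  c-representative : ∀ i → c (representative i) ≡ i
  c-representative i = proj₂ (c-surj i) refl

  p-representative-injective : Injective _≡_ _≡_ (p ∘ representative)
  p-representative-injective {i} {j} eq =
    trans (sym (c-representative i)) (trans (proj₁ (c-perp _ _) (proj₂ perp-aa (p⇒perp eq))) (c-representative j))

  -- Different parts of the graph lie in different parts of `Ē`, and there are `k` of either kind;
  -- an injective map of `Fin k` to itself is onto.
  p-surj : ∀ i → ∃[ x ] p x ≡ i
  p-surj i = let j , eq = injective⇒surjective p-representative-injective i in representative j , eq

  l : Fin k → Fin v → Bool
  l i x = Ē (t i) (α x)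

  l-own : ∀ x → l (p x) x ≡ false
  l-own x = proj₂ (x⊥t x)

  flip-edge : ∀ {w w′} → ¬ Perp Ē w w′ → Ē w w′ ≡ not (Ē w′ w)
  flip-edge {w} {w′} ¬perp with Ē w w′ in eq | Ē w′ w in eq′
  ... | true  | true  with () ← trans (sym eq′) (proj₂ Ē-digraph w w′ eq)
  ... | true  | false = refl
  ... | false | true  = refl
  ... | false | false = contradiction (refl , refl) ¬perp

  xor-of-parity : ∀ e s t′ → 2 ∣ b2n e + b2n (not s) + b2n t′ + b2n true → e ≡ t′ xor s
  xor-of-parity true  true  true  d = contradiction d (from-no (2 ∣? 3))
  xor-of-parity true  true  false d = refl
  xor-of-parity true  false true  d = refl
  xor-of-parity true  false false d = contradiction d (from-no (2 ∣? 3))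
  xor-of-parity false true  true  d = refl
  xor-of-parity false true  false d = contradiction d (from-no (2 ∣? 1))
  xor-of-parity false false true  d = contradiction d (from-no (2 ∣? 3))
  xor-of-parity false false false d = refl

  -- The parity constraint for {x, t_i} and {u, t_j}.
  E-< : ∀ x u → toℕ (p x) < toℕ (p u) → Ē (α x) (α u) ≡ l (p x) u xor l (p u) x
  E-< x u px<pu = xor-of-parity (Ē (α x) (α u)) (l (p u) x) (l (p x) u)
    (subst₂ (λ e e′ → 2 ∣ b2n (Ē (α x) (α u)) + b2n e + b2n (l (p x) u) + b2n e′)
      (flip-edge λ perp → px≢pu (t-sep _ _ (≈.trans (≈.sym (x⊥t x)) perp)))
      (Ē-tt _ _ px<pu)
      (Ē-parity (α x) (t (p x)) (α u) (t (p u)) (x⊥t x) (x⊥t u) (px≢pu ∘ perp⇒p) (a≢t x _) (a≢t u _)))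
    where
    px≢pu : p x ≢ p u
    px≢pu = <⇒≢ px<pu

  E≡edge : ∀ x u → E M x u ≡ edge p l x u
  E≡edge x u with <-cmp (toℕ (p x)) (toℕ (p u))
  ... | tri< lt′ _ _ = trans (sym (Ē-aa x u)) (trans (E-< x u lt′) (sym (orient-< lt′ _ _)))
  ... | tri≈ _ eq _  = trans (sym (Ē-aa x u)) (trans (proj₁ (p⇒perp (toℕ-injective eq)))
                         (sym (edge-same p l (toℕ-injective eq))))
  ... | tri> _ _ gt  = begin
    E M x u                          ≡⟨ Ē-aa x u ⟨
    Ē (α x) (α u)                    ≡⟨ flip-edge (λ perp → <⇒≢ gt (sym (perp⇒p perp))) ⟩
    not (Ē (α u) (α x))              ≡⟨ cong not (E-< u x gt) ⟩
    not (l (p u) x xor l (p x) u)    ≡⟨ cong not (xor-comm (l (p u) x) (l (p x) u)) ⟩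
    not (l (p x) u xor l (p u) x)    ≡⟨ orient-> gt _ _ ⟨
    edge p l x u                     ∎
    where open ≡-Reasoning

  R≡l : ∀ x u → R M x u ≡ l (p x) u
  R≡l x u with R M x u in eq
  ... | true with _ , i , x⊥ti , ti→u ← proj₁ (R-spec x u) eq
             with refl ← t-sep i (p x) (≈.trans (≈.sym x⊥ti) (x⊥t x)) = sym ti→u
  ... | false with l (p x) u in eq′
  ...   | false = refl
  ...   | true = contradiction (trans (sym eq) (proj₂ (R-spec x u) (x≁u , p x , x⊥t x , eq′))) λ ()
    where
    x≁u : ¬ Perp (E M) x u
    x≁u perp with () ← trans (sym eq′) (trans (cong (λ i → l i u) (perp⇒p (proj₁ perp-aa perp))) (l-own u))

  -- Suppose the part of `y` came earlier, and compare `y` with `t (p x)`. Either `y` lies between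
  -- `x` and `t (p x)`, or `t (p x)` lies between `t (p y)` and `y`; in both cases convexity
  -- identifies two different parts.
  L⇒p≤ : ∀ x y → L M x y ≡ true → toℕ (p x) ≤ toℕ (p y)
  L⇒p≤ x y x<y = ≮⇒≥ impossible
    where
    impossible : ¬ toℕ (p y) < toℕ (p x)
    impossible py<px with lt-total (α y) (t (p x)) (a≢t y _)
    ... | inj₁ y<t = <⇒≢ py<px (sym (perp⇒p
                       (lt-convex (α x) (α y) (t (p x)) (trans (sym (L-spec x y)) x<y) y<t (x⊥t x))))
    ... | inj₂ t<y = <⇒≢ py<px (t-sep _ _
                       (lt-convex (t (p y)) (t (p x)) (α y) (lt-tt _ _ py<px) t<y (≈.sym (x⊥t y))))

  L-linear : IsStrictLinear (L M)
  L-linear = (λ x → trans (L-spec x x) (lt-irrefl (α x)))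
           , (λ x y z x<y y<z → trans (L-spec x z) (lt-trans _ _ _
               (trans (sym (L-spec x y)) x<y) (trans (sym (L-spec y z)) y<z)))
           , λ x y x≢y → Sum.map (trans (L-spec x y)) (trans (L-spec y x))
               (lt-total (α x) (α y) (x≢y ∘ ↑ˡ-injective k x y))

  open Rank L-linear

  N : Normal
  N = record
    { #v = v ; #p = k ; p = p ∘ unrank
    ; p-surj = λ i → let x , eq = p-surj i in rank x , trans (cong p (unrank-rank x)) eq
    ; p-mono = λ {i} {j} → mono i j
    ; l = λ i → l i ∘ unrank
    ; l-own = λ i → l-own (unrank i) }
    where
    mono : ∀ i j → toℕ i ≤ toℕ j → toℕ (p (unrank i)) ≤ toℕ (p (unrank j))
    mono i j i≤j with i ≟ j
    ... | yes refl = ≤-refl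
    ... | no  i≢j  = L⇒p≤ _ _ (trans (sym (unrank-lt i j)) (<⇒<ᵇ≡true (≤∧≢⇒< i≤j (i≢j ∘ toℕ-injective))))

-- Rigid surjections as parameter words

-- The change of names when the first parameter opens: it becomes the letter `zero`, and the
-- remaining parameters move down by one.
rebase : Fin a ⊎ Fin (suc k) → Fin (suc a) ⊎ Fin k
rebase (inj₁ c)       = inj₁ (suc c)
rebase (inj₂ zero)    = inj₁ zero
rebase (inj₂ (suc j)) = inj₂ j

rebase-inj₂ : ∀ (z : Fin a ⊎ Fin (suc k)) {j} → rebase z ≡ inj₂ j → z ≡ inj₂ (suc j)
rebase-inj₂ (inj₂ (suc j)) refl = refl

rebase-▸ : ∀ (x : X) (σ : Fin a → X) (u : Vec X k) z →
  [ x ▸ σ , lookup u ]′ (rebase z) ≡ [ σ , lookup (x ∷ u) ]′ z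
rebase-▸ x σ u (inj₁ c)       = refl
rebase-▸ x σ u (inj₂ zero)    = refl
rebase-▸ x σ u (inj₂ (suc j)) = refl

Spells : (Fin n → Fin a ⊎ Fin k) → PWord a k n → Set₁
Spells f W = ∀ {X : Set} σ (u : Vec X _) → act σ W u ≡ tabulate ([ σ , lookup u ]′ ∘ f)

restricted-growth-word : (f : Fin n → Fin a ⊎ Fin k) → (∀ j → ∃[ i ] f i ≡ inj₂ j) →
  (∀ i {j j′} → f i ≡ inj₂ j → toℕ j′ < toℕ j → ∃[ i′ ] (toℕ i′ < toℕ i × f i′ ≡ inj₂ j′)) →
  Σ (PWord a k n) (Spells f)
restricted-growth-word {zero} {k = zero}  f onto growth = ε , λ { σ [] → refl }
restricted-growth-word {zero} {k = suc k} f onto growth = case onto zero of λ { (() , _) }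
restricted-growth-word {suc n} {a} {k} f onto growth with f zero in eq
... | inj₁ c =
  let W , spells = restricted-growth-word (f ∘ suc) onto′ growth′
  in letter c W , λ σ u → cong (σ c ∷_) (spells σ u)
  where
  onto′ : ∀ j → ∃[ i ] f (suc i) ≡ inj₂ j
  onto′ j with onto j
  ... | suc i , e = i , e
  ... | zero  , e with () ← trans (sym eq) e

  growth′ : ∀ i {j j′} → f (suc i) ≡ inj₂ j → toℕ j′ < toℕ j → ∃[ i′ ] (toℕ i′ < toℕ i × f (suc i′) ≡ inj₂ j′)
  growth′ i e j′<j with growth (suc i) e j′<j
  ... | suc i′ , lt , e′ = i′ , s≤s⁻¹ lt , e′
  ... | zero   , lt , e′ with () ← trans (sym eq) e′
restricted-growth-word {suc n} {a} {suc k} f onto growth | inj₂ (suc j)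
  with () ← proj₁ (proj₂ (growth zero {j′ = zero} eq (s≤s z≤n)))
restricted-growth-word {suc n} {a} {suc k} f onto growth | inj₂ zero =
  let W , spells = restricted-growth-word (rebase ∘ f ∘ suc) onto′ growth′
  in param W , λ { σ (x ∷ u) → cong (x ∷_)
       (trans (spells (x ▸ σ) u) (tabulate-cong (rebase-▸ x σ u ∘ f ∘ suc))) }
  where
  onto′ : ∀ j → ∃[ i ] rebase (f (suc i)) ≡ inj₂ j
  onto′ j with onto (suc j)
  ... | suc i , e = i , cong rebase e
  ... | zero  , e with () ← trans (sym eq) e

  growth′ : ∀ i {j j′} → rebase (f (suc i)) ≡ inj₂ j → toℕ j′ < toℕ j →
    ∃[ i′ ] (toℕ i′ < toℕ i × rebase (f (suc i′)) ≡ inj₂ j′)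
  growth′ i e j′<j with growth (suc i) (rebase-inj₂ (f (suc i)) e) (s≤s j′<j)
  ... | suc i′ , lt , e′ = i′ , s≤s⁻¹ lt , cong rebase e′
  ... | zero   , lt , e′ with () ← trans (sym eq) e′

-- By the last two hypotheses `s j` is the least element of the fibre over `j`. Monotonicity of `s`
-- then makes `F` a rigid surjection, whose fibres are the occurrences of the parameters.
rigid-word : (F : Fin n → Fin k) (s : Fin k → Fin n) → StrictMono s → (∀ j → F (s j) ≡ j) →
  (∀ i → toℕ (s (F i)) ≤ toℕ i) →
  Σ (PWord a k n) λ W → ∀ {X : Set} σ (u : Vec X k) → act σ W u ≡ tabulate (lookup u ∘ F)
rigid-word F s s-mono Fs sF = restricted-growth-word (inj₂ ∘ F) (λ j → s j , cong inj₂ (Fs j))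
  λ { i {j′ = j′} refl j′<j → s j′ , ≤-trans (s-mono j′<j) (sF i) , cong inj₂ (Fs j′) }

-- Subsets of [n] in the lexicographic order

data _≺_ : Vec Bool n → Vec Bool n → Set where
  here  : ∀ {u v : Vec Bool n} → (true ∷ u) ≺ (false ∷ v)
  there : ∀ {b} {u v : Vec Bool n} → u ≺ v → (b ∷ u) ≺ (b ∷ v)

-- `true` becomes the smaller digit because `≺` puts it first.
bit : Bool → Fin 2
bit true  = zero
bit false = suc zero

unbit : Fin 2 → Bool
unbit zero    = true
unbit (suc _) = false

unbit-bit : ∀ b → unbit (bit b) ≡ b
unbit-bit true  = refl
unbit-bit false = refl

code : Vec Bool n → Fin (2 ^ n)
code []      = zero
code (b ∷ u) = combine (bit b) (code u)

decode : ∀ n → Fin (2 ^ n) → Vec Bool n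
decode zero    c = []
decode (suc n) c = unbit (quotient {2} (2 ^ n) c) ∷ decode n (remainder {2} (2 ^ n) c)

decode-code : (u : Vec Bool n) → decode n (code u) ≡ u
decode-code         []      = refl
decode-code {suc n} (b ∷ u) = cong₂ _∷_
  (trans (cong (unbit ∘ proj₁) (remQuot-combine (bit b) (code u))) (unbit-bit b))
  (trans (cong (decode n ∘ proj₂) (remQuot-combine (bit b) (code u))) (decode-code u))

code-mono : ∀ {u v : Vec Bool n} → u ≺ v → toℕ (code u) < toℕ (code v)
code-mono (here {u = u} {v})  = combine-monoˡ-< {2} {i = zero} {j = suc zero} (code u) (code v) (s≤s z≤n)
code-mono (there {b = b} u≺v) = combine-monoʳ-< (bit b) (code-mono u≺v)

-- The two results agree until the first parameter with different values opens, and there they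
-- compare as `u` and `v` do.
act-≺ : ∀ (σ : Fin a → Bool) (W : PWord a k n) {u v} → u ≺ v → act σ W u ≺ act σ W v
act-≺ σ (letter c W) u≺v         = there (act-≺ σ W u≺v)
act-≺ σ (param W)    here        = here
act-≺ σ (param W)    (there u≺v) = there (act-≺ _ W u≺v)

tabulate-≺ : ∀ (f g : Fin n → Bool) q → f q ≡ true → g q ≡ false →
  (∀ q′ → toℕ q′ < toℕ q → f q′ ≡ g q′) → tabulate f ≺ tabulate g
tabulate-≺ f g zero    fq gq agree rewrite fq | gq = here
tabulate-≺ f g (suc q) fq gq agree rewrite agree zero (s≤s z≤n) =
  there (tabulate-≺ (f ∘ suc) (g ∘ suc) q fq gq (λ q′ q′<q → agree (suc q′) (s≤s q′<q)))

meets : Vec Bool n → Vec Bool n → Bool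
meets []      []       = false
meets (b ∷ u) (b′ ∷ v) = b ∧ b′ ∨ meets u v

-- Every parameter occurs, so a common element of `u` and `v` shows up. A parameter that is not a
-- common element joins the letters, for which disjointness is assumed.
act-meets : ∀ (σ τ : Fin a → Bool) → (∀ c → σ c ∧ τ c ≡ false) → (W : PWord a k n) → ∀ u v →
  meets (act σ W u) (act τ W v) ≡ meets u v
act-meets σ τ disjoint ε            []      []       = refl
act-meets σ τ disjoint (letter c W) u       v        rewrite disjoint c = act-meets σ τ disjoint W u v
act-meets σ τ disjoint (param W)    (b ∷ u) (b′ ∷ v) with b ∧ b′ in eq
... | true  = refl
... | false = act-meets (b ▸ σ) (b′ ▸ τ) (λ { zero → eq ; (suc c) → disjoint c }) W u v

meets-true : ∀ (f g : Fin n → Bool) q → f q ∧ g q ≡ true → meets (tabulate f) (tabulate g) ≡ true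
meets-true f g zero    eq rewrite eq = refl
meets-true f g (suc q) eq with f zero ∧ g zero
... | true  = refl
... | false = meets-true (f ∘ suc) (g ∘ suc) q eq

meets-false : ∀ (f g : Fin n → Bool) → (∀ q → f q ∧ g q ≡ false) → meets (tabulate f) (tabulate g) ≡ false
meets-false {zero}  f g disjoint = refl
meets-false {suc n} f g disjoint rewrite disjoint zero = meets-false (f ∘ suc) (g ∘ suc) (disjoint ∘ suc)

-- The first factor suppresses edges inside a part, where the two sets might meet.
sends : ∀ n → Fin (2 ^ n) → Fin (2 ^ n) × Fin (2 ^ n) → Bool
sends n i (j , c) = not (does (i ≟ j)) ∧ meets (decode n i) (decode n c)

sends-own : ∀ n i c → sends n i (i , c) ≡ false
sends-own n i c rewrite dec-true (i ≟ i) refl = refl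

-- The parts are the subsets T of [n], the vertices of the part T are the pairs (T, U), and t_T sends an
-- edge to (T′, U) iff T meets U.
universal : ℕ → Normal
universal n = record
  { #v = 2 ^ n * 2 ^ n ; #p = 2 ^ n ; p = quotient {2 ^ n} (2 ^ n)
  ; p-surj = λ i → combine i (code (replicate n true)) , cong proj₁ (remQuot-combine i _)
  ; p-mono = λ {x} {y} x≤y → ≮⇒≥ λ lt → <⇒≱ (quotient-reflects-< y x lt) x≤y
  ; l = λ i w → sends n i (remQuot {2 ^ n} (2 ^ n) w)
  ; l-own = λ w → sends-own n (quotient {2 ^ n} (2 ^ n) w) _ }
  where
  quotient-reflects-< : ∀ (y x : Fin (2 ^ n * 2 ^ n)) →
    toℕ (quotient {2 ^ n} (2 ^ n) y) < toℕ (quotient {2 ^ n} (2 ^ n) x) → toℕ y < toℕ x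
  quotient-reflects-< y x lt = subst₂ (λ y x → toℕ y < toℕ x)
    (combine-remQuot {2 ^ n} (2 ^ n) y) (combine-remQuot {2 ^ n} (2 ^ n) x) (combine-monoˡ-< _ _ lt)

combine-<⇒lex : ∀ (i j : Fin m) (x y : Fin n) → toℕ (combine i x) < toℕ (combine j y) →
  toℕ i < toℕ j ⊎ (i ≡ j × toℕ x < toℕ y)
combine-<⇒lex i j x y lt with <-cmp (toℕ i) (toℕ j)
... | tri< i<j _ _ = inj₁ i<j
... | tri> _ _ j<i = contradiction (<⇒≤ lt) (<⇒≱ (combine-monoˡ-< y x j<i))
... | tri≈ _ i≡j _ with refl ← toℕ-injective i≡j =
  inj₂ (refl , strictMono-reflects {f = combine i} (combine-monoʳ-< i) lt)

does-cong : ∀ {P Q : Set} (p? : Dec P) (q? : Dec Q) → (P → Q) → (Q → P) → does p? ≡ does q?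
does-cong (yes p) q? to from = sym (dec-true q? (to p))
does-cong (no ¬p) q? to from = sym (dec-false q? (¬p ∘ from))

-- The embedding given by a parameter word

-- Row 0 and column 0 stand for "no part" and "no vertex".  The part i is represented by row i, the
-- vertex x by the entries (i, x) of its column with i = 0 or (t_i, x) an edge.
module Grid (N : Normal) where
  open Normal N

  Cell : Set
  Cell = Fin (suc #p) × Fin (suc #v)

  #cells : ℕ
  #cells = suc #p * suc #v

  cell : Fin #cells → Cell
  cell = remQuot {suc #p} (suc #v)

  label : Fin (suc #p) → Fin (suc #v) → Bool
  label zero    c       = true
  label (suc i) zero    = true
  label (suc i) (suc x) = l i x

  inRow : Fin #p → Cell → Bool
  inRow i (j , c) = does (j ≟ suc i)

  inCol : Fin #v → Cell → Bool
  inCol x (j , c) = does (c ≟ suc x) ∧ label j c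

  grid : (Cell → Bool) → Vec Bool #cells
  grid f = tabulate (f ∘ cell)

  -- Positions that carry the only letter belong to none of the sets.
  none : Fin 1 → Bool
  none _ = false

  partCode : PWord 1 #cells n → Fin #p → Fin (2 ^ n)
  partCode W i = code (act none W (grid (inRow i)))

  vertexCode : PWord 1 #cells n → Fin #v → Fin (2 ^ n)
  vertexCode W x = code (act none W (grid (inCol x)))

  place : PWord 1 #cells n → Fin #v → Fin (2 ^ n * 2 ^ n)
  place W x = combine (partCode W (p x)) (vertexCode W x)

  private
    at : ∀ (f : Cell → Bool) j c → f (cell (combine j c)) ≡ f (j , c)
    at f j c = cong f (remQuot-combine j c)

    before : ∀ q (j : Fin (suc #p)) (c : Fin (suc #v)) → toℕ q < toℕ (combine j c) →
      toℕ (proj₁ (cell q)) < toℕ j ⊎ (proj₁ (cell q) ≡ j × toℕ (proj₂ (cell q)) < toℕ c)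
    before q j c lt = combine-<⇒lex (proj₁ (cell q)) j (proj₂ (cell q)) c
      (subst (λ q → toℕ q < toℕ (combine j c)) (sym (combine-remQuot {suc #p} (suc #v) q)) lt)

  -- The sets first differ at the cell of column 0 in the row of `i`: all earlier cells lie in rows
  -- before those of `i` and `j`.
  row-≺ : ∀ {i j} → toℕ i < toℕ j → grid (inRow i) ≺ grid (inRow j)
  row-≺ {i} {j} i<j = tabulate-≺ (inRow i ∘ cell) (inRow j ∘ cell) (combine {suc #p} {suc #v} (suc i) zero)
    (trans (at (inRow i) (suc i) zero) (dec-true (suc i ≟ suc i) refl))
    (trans (at (inRow j) (suc i) zero) (dec-false (suc i ≟ suc j) (<⇒≢ (s≤s i<j))))
    agree
    where
    agree : ∀ q → toℕ q < toℕ (combine {suc #p} {suc #v} (suc i) zero) → inRow i (cell q) ≡ inRow j (cell q)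
    agree q lt with before q (suc i) zero lt
    ... | inj₁ j′<si = trans (dec-false (_ ≟ suc i) (<⇒≢ j′<si)) (sym (dec-false (_ ≟ suc j) (<⇒≢ (<-trans j′<si (s≤s i<j)))))

  -- Row 0 has label `true` throughout, so the set of `x` contains its cell in row 0 whatever `l`
  -- is, and this cell precedes every cell of the set of `y`.
  col-≺ : ∀ {x y} → toℕ x < toℕ y → grid (inCol x) ≺ grid (inCol y)
  col-≺ {x} {y} x<y = tabulate-≺ (inCol x ∘ cell) (inCol y ∘ cell) (combine {suc #p} {suc #v} zero (suc x))
    (trans (at (inCol x) zero (suc x)) (cong (_∧ true) (dec-true (suc x ≟ suc x) refl)))
    (trans (at (inCol y) zero (suc x)) (cong (_∧ true) (dec-false (suc x ≟ suc y) (<⇒≢ (s≤s x<y)))))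
    agree
    where
    agree : ∀ q → toℕ q < toℕ (combine {suc #p} {suc #v} zero (suc x)) → inCol x (cell q) ≡ inCol y (cell q)
    agree q lt with before q zero (suc x) lt
    ... | inj₂ (_ , c<sx) = trans (cong (_∧ _) (dec-false (_ ≟ suc x) (<⇒≢ c<sx)))
                              (sym (cong (_∧ _) (dec-false (_ ≟ suc y) (<⇒≢ (<-trans c<sx (s≤s x<y))))))

  row-meets-col : ∀ i x → meets (grid (inRow i)) (grid (inCol x)) ≡ l i x
  row-meets-col i x with l i x in eq
  ... | true  = meets-true (inRow i ∘ cell) (inCol x ∘ cell) (combine (suc i) (suc x))
    (trans (at (λ c → inRow i c ∧ inCol x c) (suc i) (suc x))
      (cong₂ _∧_ (dec-true (suc i ≟ suc i) refl) (cong₂ _∧_ (dec-true (suc x ≟ suc x) refl) eq)))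
  ... | false = meets-false (inRow i ∘ cell) (inCol x ∘ cell) (disjoint ∘ cell)
    where
    disjoint : ∀ c → inRow i c ∧ inCol x c ≡ false
    disjoint (j , c) with j ≟ suc i | c ≟ suc x
    ... | no _     | _        = refl
    ... | yes _    | no _     = refl
    ... | yes refl | yes refl = eq

  partCode-mono : ∀ (W : PWord 1 #cells n) → StrictMono (partCode W)
  partCode-mono W i<j = code-mono (act-≺ none W (row-≺ i<j))

  place-mono : ∀ (W : PWord 1 #cells n) → StrictMono (place W)
  place-mono W {x} {y} x<y with <-cmp (toℕ (p x)) (toℕ (p y))
  ... | tri< lt _ _ = combine-monoˡ-< _ _ (partCode-mono W lt)
  ... | tri> _ _ gt = contradiction (p-mono (<⇒≤ x<y)) (<⇒≱ gt)
  ... | tri≈ _ eq _ rewrite toℕ-injective eq =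
    combine-monoʳ-< (partCode W (p y)) (code-mono (act-≺ none W (col-≺ x<y)))

  placeEmb : PWord 1 #cells n → Emb structure (Normal.structure (universal n))
  placeEmb {n} W = normalEmb N (universal n) (place W) (partCode W) (place-mono W) (partCode-mono W)
    (λ x → cong proj₁ (remQuot-combine (partCode W (p x)) _)) place-l
    where
    place-l : ∀ i u → Normal.l (universal n) (partCode W i) (place W u) ≡ l i u
    place-l i u = begin
      sends n (partCode W i) (remQuot {2 ^ n} (2 ^ n) (place W u))
        ≡⟨ cong (sends n (partCode W i)) (remQuot-combine (partCode W (p u)) (vertexCode W u)) ⟩
      apart ∧ meets (decode n (partCode W i)) (decode n (vertexCode W u))
        ≡⟨ cong₂ (λ T U → apart ∧ meets T U) (decode-code (act none W (grid (inRow i)))) (decode-code (act none W (grid (inCol u)))) ⟩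
      apart ∧ meets (act none W (grid (inRow i))) (act none W (grid (inCol u)))
        ≡⟨ cong (apart ∧_) (act-meets none none (λ _ → refl) W _ _) ⟩
      apart ∧ meets (grid (inRow i)) (grid (inCol u))
        ≡⟨ cong (apart ∧_) (row-meets-col i u) ⟩
      apart ∧ l i u
        ≡⟨ absorb ⟩
      l i u ∎
      where
      open ≡-Reasoning
      apart = not (does (partCode W i ≟ partCode W (p u)))

      -- Distinct parts have distinct codes, so the factor `apart` removes only values that `l-own`
      -- already makes false.
      absorb : apart ∧ l i u ≡ l i u
      absorb with partCode W i ≟ partCode W (p u)
      ... | no _   = refl
      ... | yes eq = sym (trans (cong (λ j → l j u) (strictMono-injective (partCode-mono W) eq)) (l-own u))

-- The parameter word of an embedding

lift : (Fin m → Fin n) → Fin (suc m) → Fin (suc n)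
lift f = zero ▸ suc ∘ f

lift-mono : ∀ {f : Fin m → Fin n} → StrictMono f → StrictMono (lift f)
lift-mono f-mono {zero}  {suc y} x<y       = s≤s z≤n
lift-mono f-mono {suc x} {suc y} (s≤s x<y) = s≤s (f-mono x<y)

retract : (Fin m → Fin n) → Fin (suc n) → Fin (suc m)
retract f zero    = zero
retract f (suc y) with any? (λ x → f x ≟ y)
... | yes (x , _) = suc x
... | no  _       = zero

retract-lift : ∀ {f : Fin m → Fin n} → Injective _≡_ _≡_ f → ∀ x → retract f (lift f x) ≡ x
retract-lift         f-inj zero    = refl
retract-lift {f = f} f-inj (suc x) with any? (λ x′ → f x′ ≟ f x)
... | yes (x′ , eq) = cong suc (f-inj eq)
... | no  ¬hit      = contradiction (x , refl) ¬hit

retract-suc : ∀ (f : Fin m → Fin n) y {x} → retract f y ≡ suc x → y ≡ suc (f x)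
retract-suc f (suc y) eq with any? (λ x → f x ≟ y)
retract-suc f (suc y) refl | yes (x , fx≡y) = cong suc (sym fx≡y)

lift-retract-≤ : ∀ (f : Fin m → Fin n) y {x} → x ≡ zero ⊎ x ≡ retract f y → toℕ (lift f x) ≤ toℕ y
lift-retract-≤ f y {zero}  _         = z≤n
lift-retract-≤ f y {suc x} (inj₂ eq) = ≤-reflexive (cong toℕ (sym (retract-suc f y (sym eq))))

combine-mono-≤ : ∀ {i j : Fin m} {x y : Fin n} → toℕ i ≤ toℕ j → toℕ x ≤ toℕ y →
  toℕ (combine i x) ≤ toℕ (combine j y)
combine-mono-≤ {n = n} {i} {j} {x} {y} i≤j x≤y rewrite toℕ-combine i x | toℕ-combine j y =
  +-mono-≤ (*-monoʳ-≤ n i≤j) x≤y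

combine-lex-mono : ∀ {m′ n′} {f : Fin m → Fin m′} {g : Fin n → Fin n′} → StrictMono f → StrictMono g →
  ∀ i j x y → toℕ (combine i x) < toℕ (combine j y) → toℕ (combine (f i) (g x)) < toℕ (combine (f j) (g y))
combine-lex-mono {f = f} f-mono g-mono i j x y lt with combine-<⇒lex i j x y lt
... | inj₁ i<j          = combine-monoˡ-< _ _ (f-mono i<j)
... | inj₂ (refl , x<y) = combine-monoʳ-< (f i) (g-mono x<y)

module _ (A B : Normal) (e : Emb (Normal.structure A) (Normal.structure B)) where
  private
    module A = Normal A
    module B = Normal B
    module GA = Grid A
    module GB = Grid B

    f : Fin A.#v → Fin B.#v
    f = fun e

    f-mono : StrictMono f
    f-mono {x} {y} x<y = <ᵇ≡true⇒< (trans (sym (presL e x y)) (<⇒<ᵇ≡true x<y))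

    f-part : ∀ {x y} → A.p x ≡ A.p y → B.p (f x) ≡ B.p (f y)
    f-part {x} {y} eq with xy , yx ← proj₂ (edge-perp A.p A.l x y) eq =
      proj₁ (edge-perp B.p B.l (f x) (f y)) (trans (sym (presE e x y)) xy , trans (sym (presE e y x)) yx)

    f-part⁻ : ∀ {x y} → B.p (f x) ≡ B.p (f y) → A.p x ≡ A.p y
    f-part⁻ {x} {y} eq with xy , yx ← proj₂ (edge-perp B.p B.l (f x) (f y)) eq =
      proj₁ (edge-perp A.p A.l x y) (trans (presE e x y) xy , trans (presE e y x) yx)

    rep : Fin A.#p → Fin A.#v
    rep i = proj₁ (A.p-surj i)

    p-rep : ∀ i → A.p (rep i) ≡ i
    p-rep i = proj₂ (A.p-surj i)

    φ : Fin A.#p → Fin B.#p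
    φ i = B.p (f (rep i))

    φ-mono : StrictMono φ
    φ-mono {i} {j} i<j = ≤∧≢⇒< (B.p-mono (<⇒≤ (f-mono rep<rep))) (φi≢φj ∘ toℕ-injective)
      where
      rep<rep : toℕ (rep i) < toℕ (rep j)
      rep<rep = ≰⇒> λ rj≤ri → <⇒≱ i<j
        (subst₂ (λ i j → toℕ j ≤ toℕ i) (p-rep i) (p-rep j) (A.p-mono rj≤ri))

      φi≢φj : φ i ≢ φ j
      φi≢φj eq = <⇒≢ i<j (trans (sym (p-rep i)) (trans (f-part⁻ eq) (p-rep j)))

    f-l : ∀ i u → A.l i u ≡ B.l (φ i) (f u)
    f-l i u = trans (cong (λ j → A.l j u) (sym (p-rep i))) (presR e (rep i) u)

    positive : Fin (suc n) → Bool
    positive zero    = false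
    positive (suc _) = true

    -- Cells outside the copy of A are merged into the cells of A that meet the same rows and columns.
    coarsen : GB.Cell → GA.Cell
    coarsen (j , c) = retract φ j , (if positive (retract φ j) ∨ GB.label j c then retract f c else zero)

    refine : GA.Cell → GB.Cell
    refine (i , x) = lift φ i , lift f x

    coarsen-refine : ∀ c → coarsen (refine c) ≡ c
    coarsen-refine (i , x)
      rewrite retract-lift (strictMono-injective φ-mono) i | retract-lift (strictMono-injective f-mono) x =
      cong (i ,_) (visible i)
      where
      visible : ∀ i → (if positive i ∨ GB.label (lift φ i) (lift f x) then x else zero) ≡ x
      visible zero    = refl
      visible (suc i) = refl

    if-cases : ∀ b {x y : X} → (if b then x else y) ≡ y ⊎ (if b then x else y) ≡ x
    if-cases true  = inj₂ refl
    if-cases false = inj₁ refl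

    F : Fin GB.#cells → Fin GA.#cells
    F q = uncurry combine (coarsen (GB.cell q))

    s : Fin GA.#cells → Fin GB.#cells
    s q = uncurry combine (refine (GA.cell q))

    s-mono : StrictMono s
    s-mono {q} {q′} q<q′ = combine-lex-mono (lift-mono φ-mono) (lift-mono f-mono)
      (proj₁ (GA.cell q)) (proj₁ (GA.cell q′)) (proj₂ (GA.cell q)) (proj₂ (GA.cell q′))
      (subst₂ (λ q q′ → toℕ q < toℕ q′) (sym (combine-remQuot {suc A.#p} (suc A.#v) q))
        (sym (combine-remQuot {suc A.#p} (suc A.#v) q′)) q<q′)

    Fs : ∀ q → F (s q) ≡ q
    Fs q = trans (cong (uncurry combine ∘ coarsen) (uncurry remQuot-combine (refine (GA.cell q))))
             (trans (cong (uncurry combine) (coarsen-refine (GA.cell q))) (combine-remQuot {suc A.#p} (suc A.#v) q))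

    -- Coarsening keeps an index or sends it to 0, and `refine` restores what was kept. Thus
    -- `refine` picks the least cell of each fibre, as a rigid surjection requires.
    refine-coarsen-≤ : ∀ c → toℕ (uncurry combine (refine (coarsen c))) ≤ toℕ (uncurry combine c)
    refine-coarsen-≤ (j , c) = combine-mono-≤ (lift-retract-≤ φ j (inj₂ refl))
      (lift-retract-≤ f c (if-cases (positive (retract φ j) ∨ GB.label j c)))

    sF : ∀ q → toℕ (s (F q)) ≤ toℕ q
    sF q = ≤-trans
      (≤-reflexive (cong (toℕ ∘ uncurry combine ∘ refine) (uncurry remQuot-combine (coarsen (GB.cell q)))))
      (≤-trans (refine-coarsen-≤ (GB.cell q)) (≤-reflexive (cong toℕ (combine-remQuot {suc B.#p} (suc B.#v) q))))

    row-coarsen : ∀ i c → GA.inRow i (coarsen c) ≡ GB.inRow (φ i) c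
    row-coarsen i (j , c) = does-cong (_ ≟ _) (_ ≟ _) (retract-suc φ j)
      λ { refl → retract-lift (strictMono-injective φ-mono) (suc i) }

    -- In the column of `f x`, a cell of a row in the image of `φ` has the same label in both
    -- structures by `f-l`. A cell of a lost row goes to row 0 of the column of `x` if it belongs to
    -- the set of `f x`, and to (0, 0) otherwise; row 0 always belongs to the set of `x`.
    col-coarsen : ∀ x c → GA.inCol x (coarsen c) ≡ GB.inCol (f x) c
    col-coarsen x (j , c) with c ≟ suc (f x)
    ... | no c≢ = cong (_∧ _) (dec-false (_ ≟ suc x) miss)
      where
      miss : (if positive (retract φ j) ∨ GB.label j c then retract f c else zero) ≢ suc x
      miss eq with if-cases (positive (retract φ j) ∨ GB.label j c) {retract f c} {zero}
      ... | inj₁ eq′ with () ← trans (sym eq) eq′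
      ... | inj₂ eq′ = c≢ (retract-suc f c (trans (sym eq′) eq))
    ... | yes refl rewrite retract-lift (strictMono-injective f-mono) (suc x) with retract φ j in eq
    ...   | suc i with refl ← retract-suc φ j eq = trans (cong (_∧ A.l i x) (dec-true (suc x ≟ suc x) refl)) (f-l i x)
    ...   | zero with GB.label j (suc (f x))
    ...     | true  = cong (_∧ true) (dec-true (suc x ≟ suc x) refl)
    ...     | false = refl

    embWord′ : Σ (PWord 1 GA.#cells GB.#cells) λ W → ∀ {X : Set} σ (u : Vec X _) → act σ W u ≡ tabulate (lookup u ∘ F)
    embWord′ = rigid-word F s s-mono Fs sF

  embWord : PWord 1 GA.#cells GB.#cells
  embWord = proj₁ embWord′

  private
    act-grid : ∀ (g : GA.Cell → Bool) (h : GB.Cell → Bool) → (∀ c → g (coarsen c) ≡ h c) →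
      act GA.none embWord (GA.grid g) ≡ GB.grid h
    act-grid g h eq = trans (proj₂ embWord′ GA.none (GA.grid g)) (tabulate-cong λ q →
      trans (lookup∘tabulate (g ∘ GA.cell) (F q))
        (trans (cong g (uncurry remQuot-combine (coarsen (GB.cell q)))) (eq (GB.cell q))))

  place-embWord : ∀ (W : PWord 1 GB.#cells n) x → GA.place (W ⊙ embWord) x ≡ GB.place W (f x)
  place-embWord W x = cong₂ combine
    (trans (cong code (trans (act-plug GA.none id W embWord _)
      (cong (act GB.none W) (act-grid (GA.inRow (A.p x)) _ (row-coarsen (A.p x))))))
      (cong (GB.partCode W) (f-part (p-rep (A.p x)))))
    (cong code (trans (act-plug GA.none id W embWord _)
      (cong (act GB.none W) (act-grid (GA.inCol x) _ (col-coarsen x)))))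

-- Copies inside a placed structure, and the conclusion

infixr 9 _∘ᵉ_
_∘ᵉ_ : ∀ {A B C} → Emb B C → Emb A B → Emb A C
g ∘ᵉ f = record
  { fun = fun g ∘ fun f ; inj = inj f ∘ inj g
  ; presE = λ x y → trans (presE f x y) (presE g _ _)
  ; presR = λ x y → trans (presR f x y) (presR g _ _)
  ; presL = λ x y → trans (presL f x y) (presL g _ _) }

factor : ∀ {A B C} (g : Emb B C) (h : Emb A C) → (∀ x → ∃[ y ] fun g y ≡ fun h x) → Emb A B
factor {A} {B} {C} g h lifts = record
  { fun = proj₁ ∘ lifts
  ; inj = λ {x} {x′} eq → inj h (trans (sym (proj₂ (lifts x))) (trans (cong (fun g) eq) (proj₂ (lifts x′))))
  ; presE = pres E presE
  ; presR = pres R presR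
  ; presL = pres L presL }
  where
  pres : (Q : ∀ M → Rel₂ (size M)) →
    (∀ {M M′} (k : Emb M M′) x y → Q M x y ≡ Q M′ (fun k x) (fun k y)) →
    ∀ x y → Q A x y ≡ Q B (proj₁ (lifts x)) (proj₁ (lifts y))
  pres Q presQ x y = trans (presQ h x y) (trans
    (sym (cong₂ (Q C) (proj₂ (lifts x)) (proj₂ (lifts y)))) (sym (presQ g _ _)))

idᵉ : ∀ {A} → Emb A A
idᵉ = record { fun = id ; inj = id ; presE = λ _ _ → refl ; presR = λ _ _ → refl ; presL = λ _ _ → refl }

image : (Fin m → Fin n) → Subset n
image f = tabulate λ y → does (any? λ x → f x ≟ y)

∈-image⁺ : ∀ (f : Fin m → Fin n) x → f x ∈ image f
∈-image⁺ f x = ∈-tabulate⁺ _ (dec-true (any? _) (x , refl))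

∈-image⁻ : ∀ (f : Fin m → Fin n) {y} → y ∈ image f → ∃[ x ] f x ≡ y
∈-image⁻ f {y} y∈ with any? (λ x → f x ≟ y) | ∈-tabulate⁻ _ y∈
... | yes hit | _ = hit

wordEmb : ∀ {B} → ((NB , _) : NormalForm B) → PWord 1 (Grid.#cells NB) n → Emb B (Normal.structure (universal n))
wordEmb (NB , eB , eB-onto) W = Grid.placeEmb NB W ∘ᵉ factor eB idᵉ eB-onto

-- A copy of `A` inside the image of `B` is the image of an embedding that factors through the
-- placement of `B`. The factor has a word, and composing it with `W` places `A` on exactly this
-- copy.
copy-in-wordEmb : ∀ {A B} ((NA , _) : NormalForm A) (nfB@(NB , _) : NormalForm B) (W : PWord 1 (Grid.#cells NB) n) S →
  IsCopy A (Normal.structure (universal n)) S → InImage {B} S (wordEmb nfB W) →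
  ∃[ v ] S ≡ image (Grid.place NA (W ⊙ v))
copy-in-wordEmb (NA , eA , eA-onto) (NB , eB , eB-onto) W S (e , S-copy) S⊆g = embWord NA NB e′ , ⊆-antisym
    (λ {y} y∈S → let x , ex≡y = proj₁ (S-copy y) y∈S
                     x′ , eq  = eA-onto x
                 in subst (_∈ image placeA) (trans (placed x′) (trans (cong (fun e) eq) ex≡y)) (∈-image⁺ placeA x′))
    (λ {y} y∈ → let x , eq = ∈-image⁻ placeA y∈
                in proj₂ (S-copy y) (fun eA x , trans (sym (placed x)) eq))
  where
  g = Grid.placeEmb NB W
  h = e ∘ᵉ eA

  lifts : ∀ x → ∃[ y ] fun g y ≡ fun h x
  lifts x = let y , eq = S⊆g (fun h x) (proj₂ (S-copy _) (_ , refl)) in _ , eq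

  e′ : Emb (Normal.structure NA) (Normal.structure NB)
  e′ = factor g h lifts

  placeA = Grid.place NA (W ⊙ embWord NA NB e′)

  placed : ∀ x → placeA x ≡ fun h x
  placed x = trans (place-embWord NA NB e′ W x) (proj₂ (lifts x))

theorem10p6 : RamseyProperty InSStar
-- With no colours there is no colouring: already the empty set could not be coloured.
theorem10p6 zero    A B A∈ B∈ = Normal.structure (universal 0) , normal∈𝒮* (universal 0) , λ χ → case χ ⊥ of λ ()
theorem10p6 (suc r) A B A∈ B∈ =
  let nfA@(NA , _) = normalise A A∈
      nfB@(NB , _) = normalise B B∈
      n , ramsey   = graham-rothschild (Grid.#cells NA) 0 (Grid.#cells NB) (suc r) zero
  in Normal.structure (universal n) , normal∈𝒮* (universal n) , λ χ →
     -- A word takes the colour of the copy of `A` that it places.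
     let W , c , mono = ramsey (χ ∘ image ∘ Grid.place NA)
     in wordEmb nfB W , c , λ S S-copy S⊆g →
        let v , S≡image = copy-in-wordEmb nfA nfB W S S-copy S⊆g
        in trans (cong χ S≡image) (mono v)
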